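{- Let $G \ne K_4$ be a connected, claw-free, cubic graph of order $n$. Then $F_t(G) \le \frac{1}{2}n$, with equality if and only if $G \in \mathcal{N}_{\rm cubic}$ or $G$ is the prism $C_3 \,\Box\, K_2$.
   Context: Graphs are finite and simple. A graph is claw-free if it contains no induced subgraph isomorphic to $K_{1,3}$. Forcing process: given a graph $G$ and a set $S \subseteq V(G)$ of initially colored vertices, at each step, if a colored vertex has exactly one non-colored neighbor, that neighbor becomes colored. $S$ is a forcing set if iterating this process colors all of $V(G)$. A total forcing set is a forcing set $S$ such that $G[S]$ has no isolated vertex; $F_t(G)$ is the minimum size of a total forcing set. A diamond is $K_4$ minus one edge. For $k \ge 2$, the diamond-necklace $N_k$ is obtained from $k$ disjoint diamonds $D_1,\dots,D_k$, with $V(D_i)=\{a_i,b_i,c_i,d_i\}$ and $a_ib_i$ the missing edge of $D_i$, by adding the edges $a_ib_{i+1}$ for $i \in \{1,\dots,k-1\}$ and the edge $a_kb_1$. $\mathcal{N}_{\rm cubic} = \{N_k : k \ge 2\}$. The prism $C_3 \,\Box\, K_2$ is the Cartesian product of a triangle and an edge. -}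

module Defs where

open import Data.Nat using (ℕ; zero; suc; _+_; _*_; _≡ᵇ_; _%_; _/_)
open import Data.Bool using (Bool; true; false; T; not; _∧_; _∨_; if_then_else_)
open import Data.Fin using (Fin; toℕ; _≟_)
import Data.Fin as F
open import Data.Product using (Σ; _×_; ∃; ∃-syntax; _,_)
open import Data.Sum using (_⊎_)
open import Relation.Nullary using (¬_)
open import Data.Empty using (⊥)
open import Relation.Nullary.Decidable using (⌊_⌋)
open import Relation.Binary.PropositionalEquality using (_≡_; _≢_)
open import Function.Bundles using (_↔_; Inverse)

Graph : ℕ → Set
Graph n = Fin n → Fin n → Bool

IsSimple : ∀ {n} → Graph n → Set
IsSimple {n} G = (∀ x → G x x ≡ false) × (∀ x y → G x y ≡ G y x)

count : ∀ {n} → (Fin n → Bool) → ℕ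
count {zero} p = 0
count {suc n} p = (if p F.zero then 1 else 0) + count {n} (λ i → p (F.suc i))

degree : ∀ {n} → Graph n → Fin n → ℕ
degree G v = count (G v)

Cubic : ∀ {n} → Graph n → Set
Cubic G = ∀ v → degree G v ≡ 3

data Reach {n} (G : Graph n) (u : Fin n) : Fin n → Set where
  here : Reach G u u
  step : ∀ {v w} → Reach G u v → T (G v w) → Reach G u w

Connected : ∀ {n} → Graph n → Set
Connected {n} G = Fin n × (∀ u v → Reach G u v)

ClawFree : ∀ {n} → Graph n → Set
ClawFree {n} G = ∀ (v x y z : Fin n) →
  T (G v x) → T (G v y) → T (G v z) →
  x ≢ y → x ≢ z → y ≢ z →
  G x y ≡ false → G x z ≡ false → G y z ≡ false → ⊥

VSet : ℕ → Set
VSet n = Fin n → Bool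

-- Colored G S v : v gets coloured by the forcing process started from S.
-- Rule: if u is coloured and w is the unique non-coloured neighbour of u
-- (i.e. all neighbours of u other than w are coloured), then w becomes coloured.
data Colored {n} (G : Graph n) (S : VSet n) : Fin n → Set where
  init  : ∀ {v} → T (S v) → Colored G S v
  force : ∀ {u w} → Colored G S u → T (G u w) →
          (∀ x → T (G u x) → x ≢ w → Colored G S x) → Colored G S w

ForcingSet : ∀ {n} → Graph n → VSet n → Set
ForcingSet G S = ∀ v → Colored G S v

TotalForcingSet : ∀ {n} → Graph n → VSet n → Set
TotalForcingSet {n} G S =
  ForcingSet G S × (∀ v → T (S v) → ∃[ u ] (T (S u) × T (G v u)))

IsFt : ∀ {n} → Graph n → ℕ → Set
IsFt G k = (∃[ S ] (TotalForcingSet G S × count S ≡ k))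
         × (∀ S → TotalForcingSet G S → k Data.Nat.≤ count S)

Iso : ∀ {n m} → Graph n → Graph m → Set
Iso {n} {m} G H = Σ (Fin n ↔ Fin m) λ f →
  ∀ x y → G x y ≡ H (Inverse.to f x) (Inverse.to f y)

K4 : Graph 4
K4 x y = not ⌊ x ≟ y ⌋

-- prism C3 □ K2 : triangles {0,1,2}, {3,4,5} and matching i ~ i+3
prismℕ : ℕ → ℕ → Bool
prismℕ x y =
  (((x / 3) ≡ᵇ (y / 3)) ∧ not (x ≡ᵇ y)) ∨ (((x % 3) ≡ᵇ (y % 3)) ∧ not ((x / 3) ≡ᵇ (y / 3)))

Prism : Graph 6
Prism x y = prismℕ (toℕ x) (toℕ y)

-- diamond-necklace N_k, k = 2 + m, on vertices Fin (4k).
-- Vertex 4i+j is a_i, b_i, c_i, d_i for j = 0,1,2,3 (diamond D_i, i = 0..k-1).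
-- Diamond edges: all pairs except a_i b_i.  Link edges: a_i b_{(i+1) mod k}.
diamondAdj : ℕ → ℕ → Bool
diamondAdj 0 2 = true
diamondAdj 0 3 = true
diamondAdj 1 2 = true
diamondAdj 1 3 = true
diamondAdj 2 3 = true
diamondAdj 2 0 = true
diamondAdj 3 0 = true
diamondAdj 2 1 = true
diamondAdj 3 1 = true
diamondAdj 3 2 = true
diamondAdj _ _ = false

necklaceℕ : ℕ → ℕ → ℕ → Bool
necklaceℕ m x y =
  ((i ≡ᵇ i') ∧ diamondAdj j j')
  ∨ ((j ≡ᵇ 0) ∧ (j' ≡ᵇ 1) ∧ (i' ≡ᵇ (suc i % (2 + m))))
  ∨ ((j' ≡ᵇ 0) ∧ (j ≡ᵇ 1) ∧ (i ≡ᵇ (suc i' % (2 + m))))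
  where
  i = x / 4
  j = x % 4
  i' = y / 4
  j' = y % 4

Necklace : (m : ℕ) → Graph (4 * (2 + m))
Necklace m x y = necklaceℕ m (toℕ x) (toℕ y)

InNcubic : ∀ {n} → Graph n → Set
InNcubic G = ∃[ m ] Iso G (Necklace m)

{-# OPTIONS --safe #-}
-- Every vertex lies in exactly one unit: a triangle meeting no other triangle in an edge,
-- or a diamond. Grow a set E of coloured vertices while enlarging S, keeping 2|S| ≤ |E|; a
-- diamond enters E as a whole. If an outer edge (one in no triangle) leaves E from a vertex
-- whose unit is in E, its other end is forced: an end of a diamond is paid for by adding
-- the two middle vertices to S (2 new in S, 4 new in E), and a triangle vertex comes for
-- free, a strict gain. If a triangle is entered at one vertex only, adding its other two
-- vertices to S also forces their outer neighbours (2 for 4), or its neighbouring diamond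
-- is used (3 for 6). Hence |S| ≤ n/2, with strict inequality as soon as some step gains.
--
-- Gains: two adjacent diamonds form a start with 4 for 8, and the first triangle vertex
-- reached from diamonds alone gains; if there are no adjacent diamonds, a diamond together
-- with its neighbouring triangles contains a gain. With triangles only, two triangles
-- joined by two edges form a start with 3 for 6 and the next vertex gains, unless G is the
-- prism; without such a pair the process cannot end without a gain. If there are only
-- diamonds, they form a necklace. Conversely each diamond of a necklace contains two
-- vertices of S, and a forcing set other than V(G) has at least three vertices, since the
-- first force needs a vertex of S with two neighbours in S.

module Submission where

open import Defs
open import Data.Bool using (Bool; true; false; T; not; _∧_; _∨_; if_then_else_)
open import Data.Bool.Properties using (T?; T-∨; T-∧)
open import Data.Empty using (⊥; ⊥-elim)
open import Data.Fin using (Fin; zero; suc; toℕ; fromℕ<; _≟_; #_; combine; remQuot)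
open import Data.Fin.Permutation using (↔⇒≡)
open import Data.Fin.Properties
  using (any?; all?; toℕ-fromℕ<; toℕ<n; toℕ-injective; injective⇒≤; combine-remQuot)
import Data.Fin.Properties as Finₚ
open import Data.Fin.Subset.Properties using (anySubset?)
open import Data.List using (List; []; _∷_; length; lookup)
open import Data.List.Membership.Propositional renaming (_∈_ to _∈ˡ_) using ()
open import Data.List.Membership.Propositional.Properties using (∈-lookup; ∈-++⁺ˡ; ∈-++⁺ʳ)
open import Data.List.Relation.Unary.All using (All; []; _∷_)
import Data.List.Relation.Unary.All as All
import Data.List.Relation.Unary.All.Properties as Allₚ
open import Data.List.Relation.Unary.AllPairs using ([]; _∷_)
open import Data.List.Relation.Unary.Any using () renaming (here to hereˡ; there to thereˡ)
open import Data.List.Relation.Unary.Unique.Propositional using (Unique)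
import Data.List.Relation.Unary.Unique.Propositional.Properties as Uniqueₚ
open import Data.Nat using (ℕ; zero; suc; _+_; _*_; _/_; _%_; _≡ᵇ_; _≤_; _<_; z≤n; s≤s; s≤s⁻¹)
open import Data.Nat.Divisibility using (n∣m*n)
open import Data.Nat.DivMod
  using (m≡m%n+[m/n]*n; m%n<n; m<n⇒m%n≡m; m<n⇒m/n≡0; n%n≡0; m*n/n≡m; [m+kn]%n≡m%n; m<n*o⇒m/o<n; +-distrib-/-∣ʳ)
open import Data.Nat.Properties
  using (≤-refl; ≤-trans; ≤-reflexive; ≤-antisym; <-trans; <-irrefl; <⇒≤; <⇒≱; ≤⇒≯; ≮⇒≥; _<?_;
         m≤n⇒m≤1+n; n≤1+n; n<1+n; m≤m+n; m≤n+m; m<1+n⇒m<n∨m≡n; +-identityʳ; +-suc; +-comm;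
         +-mono-≤; +-monoʳ-≤; +-monoˡ-≤; *-monoʳ-≤; *-monoˡ-≤; *-comm; ≡ᵇ⇒≡; ≡⇒≡ᵇ; <ᵇ⇒<;
         suc-injective; module ≤-Reasoning)
open import Data.Nat.Tactic.RingSolver using (solve-∀)
open import Data.Product using (Σ; ∃-syntax; _×_; _,_; proj₁; proj₂; uncurry)
open import Data.Sum using (_⊎_; inj₁; inj₂; [_,_]′)
import Data.Sum as Sum
open import Data.Unit using (tt)
import Data.Vec as Vec
open import Data.Vec.Properties using (lookup∘tabulate)
open import Function using (_∘_; id)
open import Function.Bundles using (_⇔_; mk⇔; mk↔ₛ′; Equivalence; Inverse)
open import Relation.Nullary using (¬_; Dec; yes; no; contradiction)
open import Relation.Nullary.Decidable
  using (⌊_⌋; toWitness; fromWitness; ¬?; decidable-stable; _×-dec_; _⊎-dec_; _→-dec_)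
import Relation.Nullary.Decidable as Dec
open import Relation.Binary.PropositionalEquality

private variable
  n m : ℕ

-- Counting in decidable subsets

infix 4 _∈_ _∉_
infixl 6 _⊕_

_∈_ _∉_ : Fin n → VSet n → Set
v ∈ E = T (E v)
v ∉ E = ¬ (v ∈ E)

_∈?_ : (v : Fin n) (E : VSet n) → Dec (v ∈ E)
v ∈? E = T? (E v)

∅ : VSet n
∅ _ = false

count-cong : {p q : Fin n → Bool} → (∀ i → p i ≡ q i) → count p ≡ count q
count-cong {zero}  e = refl
count-cong {suc n} e rewrite e zero = cong (_ +_) (count-cong (e ∘ suc))

count-∅ : ∀ n → count {n} ∅ ≡ 0
count-∅ zero    = refl
count-∅ (suc n) = count-∅ n

count≤ : (p : Fin n → Bool) → count p ≤ n
count≤ {zero}  p = z≤n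
count≤ {suc n} p with p zero
... | true  = s≤s (count≤ (p ∘ suc))
... | false = m≤n⇒m≤1+n (count≤ (p ∘ suc))

count-full : (p : Fin n → Bool) → (∀ v → T (p v)) → count p ≡ n
count-full {zero}  p f = refl
count-full {suc n} p f with p zero | f zero
... | true | _ = cong suc (count-full (p ∘ suc) (f ∘ suc))

abstract
  -- Opaque outside this block: membership is used only through `∈⊕⁻`, `∈⊕ˡ` and `∈⊕ʳ`, size only
  -- through the three counting lemmas.
  _⊕_ : VSet n → List (Fin n) → VSet n
  E ⊕ []       = E
  E ⊕ (x ∷ xs) = λ v → ⌊ v ≟ x ⌋ ∨ (E ⊕ xs) v

  ∈⊕⁻ : (E : VSet n) {v : Fin n} (xs : List (Fin n)) → v ∈ E ⊕ xs → v ∈ˡ xs ⊎ v ∈ E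
  ∈⊕⁻ E []       p = inj₂ p
  ∈⊕⁻ E {v} (x ∷ xs) p with Equivalence.to (T-∨ {⌊ v ≟ x ⌋}) p
  ... | inj₁ q = inj₁ (hereˡ (toWitness q))
  ... | inj₂ q = Sum.map₁ thereˡ (∈⊕⁻ E xs q)

  ∈⊕ˡ : {E : VSet n} {v : Fin n} {xs : List (Fin n)} → v ∈ˡ xs → v ∈ E ⊕ xs
  ∈⊕ˡ {v = v} {x ∷ xs} (hereˡ eq) = Equivalence.from (T-∨ {⌊ v ≟ x ⌋}) (inj₁ (fromWitness eq))
  ∈⊕ˡ {v = v} {x ∷ xs} (thereˡ p) = Equivalence.from (T-∨ {⌊ v ≟ x ⌋}) (inj₂ (∈⊕ˡ p))

  ∈⊕ʳ : {E : VSet n} {v : Fin n} (xs : List (Fin n)) → v ∈ E → v ∈ E ⊕ xs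
  ∈⊕ʳ []       p = p
  ∈⊕ʳ {v = v} (x ∷ xs) p = Equivalence.from (T-∨ {⌊ v ≟ x ⌋}) (inj₂ (∈⊕ʳ xs p))

  count-insert : (E : VSet n) (x : Fin n) → x ∉ E → count (E ⊕ (x ∷ [])) ≡ suc (count E)
  count-insert {suc n} E zero x∉E with E zero
  ... | true  = ⊥-elim (x∉E tt)
  ... | false = refl
  count-insert {suc n} E (suc x) x∉E = trans
    (cong ((if E zero then 1 else 0) +_) (trans (count-cong same) (count-insert (E ∘ suc) x x∉E)))
    (+-suc _ _)
    where
    same : ∀ i → (E ⊕ (suc x ∷ [])) (suc i) ≡ ((E ∘ suc) ⊕ (x ∷ [])) i
    same i with i ≟ x
    ... | yes _ = refl
    ... | no _  = refl

  count-⊕ : (E : VSet n) {xs : List (Fin n)} → Unique xs → All (_∉ E) xs →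
            count (E ⊕ xs) ≡ length xs + count E
  count-⊕ E []             []          = refl
  count-⊕ E {x ∷ xs} (x≢ ∷ u) (x∉E ∷ xs∉E) = trans
    (count-insert (E ⊕ xs) x (λ x∈ → [ (λ x∈xs → All.lookup x≢ x∈xs refl) , x∉E ]′ (∈⊕⁻ E xs x∈)))
    (cong suc (count-⊕ E u xs∉E))

  -- Vertices added to `S` may already be in it, so the size of `S` is bounded from above only; for
  -- `E` it is exact by `count-⊕`.
  count-⊕≤ : (E : VSet n) (xs : List (Fin n)) → count (E ⊕ xs) ≤ length xs + count E
  count-⊕≤ E [] = ≤-refl
  count-⊕≤ E (x ∷ xs) with x ∈? (E ⊕ xs)
  ... | no x∉ = ≤-trans (≤-reflexive (count-insert (E ⊕ xs) x x∉)) (s≤s (count-⊕≤ E xs))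
  ... | yes x∈ = ≤-trans (≤-reflexive (count-cong same)) (m≤n⇒m≤1+n (count-⊕≤ E xs))
    where
    absorb : ∀ b → T b → true ≡ b
    absorb true _ = refl
    same : ∀ i → (E ⊕ (x ∷ xs)) i ≡ (E ⊕ xs) i
    same i with i ≟ x
    ... | yes refl = absorb _ x∈
    ... | no _     = refl

count<n : (E : VSet n) {v : Fin n} → v ∉ E → count E < n
count<n E {v} v∉ = subst (_≤ _) (count-insert E v v∉) (count≤ (E ⊕ (v ∷ [])))

count-witness : (p : Fin n → Bool) → 0 < count p → ∃[ x ] T (p x)
count-witness {suc n} p h with p zero in eq
... | true  = zero , subst T (sym eq) tt
... | false = let (x , px) = count-witness (p ∘ suc) h in suc x , px

count-zero : (p : Fin n → Bool) → count p ≡ 0 → ∀ x → ¬ T (p x)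
count-zero p e x px with subst (0 <_) e (pos p x px)
  where
  pos : (p : Fin m → Bool) (x : Fin m) → T (p x) → 0 < count p
  pos p zero px with p zero
  ... | true = s≤s z≤n
  pos p (suc x) px = ≤-trans (pos (p ∘ suc) x px) (m≤n+m _ _)
... | ()

remove : (Fin n → Bool) → Fin n → Fin n → Bool
remove p x y = p y ∧ not ⌊ y ≟ x ⌋

∈-remove : (p : Fin n → Bool) {x y : Fin n} → T (p y) → y ≢ x → T (remove p x y)
∈-remove p {x} {y} py y≢x with p y | y ≟ x
... | true | yes e = y≢x e
... | true | no _  = tt

∈-remove⁻ : (p : Fin n → Bool) {x y : Fin n} → T (remove p x y) → T (p y) × y ≢ x
∈-remove⁻ p {x} {y} h with p y | y ≟ x
... | true | no ne = tt , ne

T-ext : ∀ {b b′} → (T b → T b′) → (T b′ → T b) → b ≡ b′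
T-ext {true}  {true}  _ _ = refl
T-ext {true}  {false} f _ = ⊥-elim (f tt)
T-ext {false} {true}  _ g = ⊥-elim (g tt)
T-ext {false} {false} _ _ = refl

count-remove : (p : Fin n → Bool) {x : Fin n} → T (p x) → count p ≡ suc (count (remove p x))
count-remove p {x} px = trans (count-cong λ i → T-ext (to i) (from i))
  (count-insert (remove p x) x (λ h → proj₂ (∈-remove⁻ p h) refl))
  where
  to : ∀ i → T (p i) → i ∈ remove p x ⊕ (x ∷ [])
  to i pi with i ≟ x
  ... | yes refl = ∈⊕ˡ (hereˡ refl)
  ... | no i≢x   = ∈⊕ʳ (x ∷ []) (∈-remove p pi i≢x)
  from : ∀ i → i ∈ remove p x ⊕ (x ∷ []) → T (p i)
  from i h with ∈⊕⁻ (remove p x) (x ∷ []) h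
  ... | inj₁ (hereˡ refl) = px
  ... | inj₂ i∈           = proj₁ (∈-remove⁻ p i∈)

count-inj : (S : VSet n) (g : Fin m → Fin n) → (∀ i j → g i ≡ g j → i ≡ j) →
            (∀ i → g i ∈ S) → m ≤ count S
count-inj {m = zero}  S g inj h = z≤n
count-inj {m = suc m} S g inj h = subst (suc m ≤_) (sym (count-remove S (h zero)))
  (s≤s (count-inj (remove S (g zero)) (g ∘ suc)
    (λ i j e → Finₚ.suc-injective (inj _ _ e))
    (λ i → ∈-remove S (h (suc i)) (λ e → contradiction (inj _ _ e) λ ()))))

lookup-injective : {A : Set} {xs : List A} → Unique xs → ∀ i j → lookup xs i ≡ lookup xs j → i ≡ j
lookup-injective (_ ∷ _)  zero    zero    _  = refl
lookup-injective (x≢ ∷ _) zero    (suc j) eq = contradiction eq (All.lookup x≢ (∈-lookup j))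
lookup-injective (x≢ ∷ _) (suc i) zero    eq = contradiction (sym eq) (All.lookup x≢ (∈-lookup i))
lookup-injective (_ ∷ u)  (suc i) (suc j) eq = cong suc (lookup-injective u i j eq)

Colored-mono : {G : Graph n} {S S′ : VSet n} → (∀ v → v ∈ S → v ∈ S′) →
               ∀ {v} → Colored G S v → Colored G S′ v
Colored-mono h (init p)      = init (h _ p)
Colored-mono h (force c e o) = force (Colored-mono h c) e (λ x p q → Colored-mono h (o x p q))


-- Block and place of a necklace vertex

abstract
  block-index : ∀ k {i j} → i < k → j < 4 → Σ (Fin (4 * k)) λ x → toℕ x / 4 ≡ i × toℕ x % 4 ≡ j
  block-index k {i} {j} i<k j<4 = fromℕ< lt , quot , rem
    where
    lt : j + i * 4 < 4 * k
    lt = ≤-trans (+-monoˡ-≤ (i * 4) j<4) (≤-trans (*-monoˡ-≤ 4 i<k) (≤-reflexive (*-comm k 4)))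
    quot : toℕ (fromℕ< lt) / 4 ≡ i
    quot rewrite toℕ-fromℕ< lt = trans (+-distrib-/-∣ʳ j (n∣m*n i)) (cong₂ _+_ (m<n⇒m/n≡0 j<4) (m*n/n≡m i 4))
    rem : toℕ (fromℕ< lt) % 4 ≡ j
    rem rewrite toℕ-fromℕ< lt = trans ([m+kn]%n≡m%n j i 4) (m<n⇒m%n≡m j<4)

block-quot< : ∀ k (x : Fin (4 * k)) → toℕ x / 4 < k
block-quot< k x = m<n*o⇒m/o<n (subst (toℕ x <_) (*-comm 4 k) (toℕ<n x))

block-ext : ∀ {m} (x y : Fin m) → toℕ x / 4 ≡ toℕ y / 4 → toℕ x % 4 ≡ toℕ y % 4 → x ≡ y
block-ext x y q r = toℕ-injective (trans (m≡m%n+[m/n]*n (toℕ x) 4)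
  (trans (cong₂ (λ q r → r + q * 4) q r) (sym (m≡m%n+[m/n]*n (toℕ y) 4))))

-- Triangles and diamonds

module ClawFreeCubic {n : ℕ} (G : Graph n) (simple : IsSimple G) (connected : Connected G)
  (clawFree : ClawFree G) (cubic : Cubic G) (G≇K4 : ¬ Iso G K4) where

  private variable
    u v w x y z p q r a b c d e f g x′ y′ z′ a′ b′ : Fin n
    E F : VSet n

  infix 4 _~_
  _~_ : Fin n → Fin n → Set
  u ~ v = T (G u v)

  ~-sym : u ~ v → v ~ u
  ~-sym {u} {v} = subst T (proj₂ simple u v)

  ~⇒≢ : u ~ v → u ≢ v
  ~⇒≢ {u} e refl = subst T (proj₁ simple u) e

  -- The order matters: the outer neighbour of a triangle vertex or of an end of a diamond stands
  -- last, and `forceN` forces the vertex in last place. `rot` and `swp` generate all six orders.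
  record Nbrs (v p q r : Fin n) : Set where
    no-eta-equality
    field
      p~  : v ~ p
      q~  : v ~ q
      r~  : v ~ r
      p≢q : p ≢ q
      p≢r : p ≢ r
      q≢r : q ≢ r
      only : v ~ u → u ≡ p ⊎ u ≡ q ⊎ u ≡ r
  open Nbrs

  rot : Nbrs v p q r → Nbrs v q r p
  rot N = record
    { p~ = q~ N ; q~ = r~ N ; r~ = p~ N
    ; p≢q = q≢r N ; p≢r = p≢q N ∘ sym ; q≢r = p≢r N ∘ sym
    ; only = λ e → [ inj₂ ∘ inj₂ , [ inj₁ , inj₂ ∘ inj₁ ]′ ]′ (only N e) }

  swp : Nbrs v p q r → Nbrs v p r q
  swp N = record
    { p~ = p~ N ; q~ = r~ N ; r~ = q~ N
    ; p≢q = p≢r N ; p≢r = p≢q N ; q≢r = q≢r N ∘ sym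
    ; only = λ e → Sum.map₂ Sum.swap (only N e) }

  flp : Nbrs v p q r → Nbrs v q p r
  flp = swp ∘ rot

  abstract
    pick : ∀ {k} (P : VSet n) → count P ≡ suc k → ∃[ x ] (x ∈ P × count (remove P x) ≡ k)
    pick P eq with count-witness P (subst (0 <_) (sym eq) (s≤s z≤n))
    ... | x , x∈ = x , x∈ , suc-injective (trans (sym (count-remove P x∈)) eq)

    threeNbrs : ∀ v → ∃[ p ] ∃[ q ] ∃[ r ] Nbrs v p q r
    threeNbrs v with pick (G v) (cubic v)
    ... | x₁ , h₁ , c₁ with pick (remove (G v) x₁) c₁
    ... | x₂ , h₂ , c₂ with pick (remove (remove (G v) x₁) x₂) c₂
    ... | x₃ , h₃ , c₃ with ∈-remove⁻ (G v) h₂ | ∈-remove⁻ (remove (G v) x₁) h₃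
    ... | v~x₂ , x₂≢x₁ | h₃′ , x₃≢x₂ with ∈-remove⁻ (G v) h₃′
    ... | v~x₃ , x₃≢x₁ = x₁ , x₂ , x₃ , record
      { p~ = h₁ ; q~ = v~x₂ ; r~ = v~x₃
      ; p≢q = x₂≢x₁ ∘ sym ; p≢r = x₃≢x₁ ∘ sym ; q≢r = x₃≢x₂ ∘ sym
      ; only = only′ }
      where
      only′ : v ~ u → u ≡ x₁ ⊎ u ≡ x₂ ⊎ u ≡ x₃
      only′ {u} e with u ≟ x₁ | u ≟ x₂ | u ≟ x₃
      ... | yes h | _ | _ = inj₁ h
      ... | no _ | yes h | _ = inj₂ (inj₁ h)
      ... | no _ | no _ | yes h = inj₂ (inj₂ h)
      ... | no ne₁ | no ne₂ | no ne₃ = ⊥-elim (count-zero _ c₃ u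
        (∈-remove (remove (remove (G v) x₁) x₂)
          (∈-remove (remove (G v) x₁) (∈-remove (G v) e ne₁) ne₂) ne₃))

    third : v ~ p → v ~ q → p ≢ q → ∃[ r ] Nbrs v p q r
    third {v} vp vq p≢q = let (_ , _ , _ , N) = threeNbrs v in go N (only N vp) (only N vq) p≢q
      where
      go : Nbrs v x y z → p ≡ x ⊎ p ≡ y ⊎ p ≡ z → q ≡ x ⊎ q ≡ y ⊎ q ≡ z → p ≢ q → ∃[ r ] Nbrs v p q r
      go N (inj₁ refl) (inj₁ refl) ne = contradiction refl ne
      go N (inj₁ refl) (inj₂ (inj₁ refl)) _ = _ , N
      go N (inj₁ refl) (inj₂ (inj₂ refl)) _ = _ , swp N
      go N (inj₂ (inj₁ refl)) (inj₁ refl) _ = _ , flp N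
      go N (inj₂ (inj₁ refl)) (inj₂ (inj₁ refl)) ne = contradiction refl ne
      go N (inj₂ (inj₁ refl)) (inj₂ (inj₂ refl)) _ = _ , rot N
      go N (inj₂ (inj₂ refl)) (inj₁ refl) _ = _ , rot (rot N)
      go N (inj₂ (inj₂ refl)) (inj₂ (inj₁ refl)) _ = _ , swp (rot (rot N))
      go N (inj₂ (inj₂ refl)) (inj₂ (inj₂ refl)) ne = contradiction refl ne

  mkNbrs : v ~ p → v ~ q → v ~ r → p ≢ q → p ≢ r → q ≢ r → Nbrs v p q r
  mkNbrs vp vq vr p≢q p≢r q≢r with third vp vq p≢q
  ... | s , N with only N vr
  ... | inj₁ refl = contradiction refl p≢r
  ... | inj₂ (inj₁ refl) = contradiction refl q≢r
  ... | inj₂ (inj₂ refl) = N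

  reach-closed : (P : Fin n → Set) → (∀ {u v} → P u → u ~ v → P v) → P u → ∀ v → P v
  reach-closed {u} P closed Pu v = go (proj₂ connected u v)
    where
    go : Reach G u w → P w
    go here       = Pu
    go (step r e) = closed (go r) e

  -- The neighbour condition makes the image of `p` closed under adjacency, so `p` is onto by
  -- connectedness. Serves for `K4`, the prism and the necklaces alike.
  mkIso : {H : Graph m} (p : Fin m → Fin n) → (∀ s t → p s ≡ p t → s ≡ t) → Fin m →
          (∀ s {y} → p s ~ y → ∃[ t ] (p t ≡ y × T (H s t))) →
          (∀ s t → T (H s t) → p s ~ p t) → Iso G H
  mkIso {m} {H} p inj s₀ nbr edge = mk↔ₛ′ to p to-p p-to , adj
    where
    surj : ∀ y → ∃[ t ] p t ≡ y
    surj = reach-closed (λ y → ∃[ t ] p t ≡ y)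
      (λ { (s , refl) e → let (t , eq , _) = nbr s e in t , eq }) (s₀ , refl)
    to : Fin n → Fin m
    to y = proj₁ (surj y)
    p-to : ∀ y → p (to y) ≡ y
    p-to y = proj₂ (surj y)
    to-p : ∀ s → to (p s) ≡ s
    to-p s = inj _ _ (p-to (p s))
    adj : ∀ x y → G x y ≡ H (to x) (to y)
    adj x y = T-ext
      (λ e → let (t , eq , h) = nbr (to x) (subst (_~ y) (sym (p-to x)) e)
             in subst (λ t → T (H (to x) t)) (inj _ _ (trans eq (sym (p-to y)))) h)
      (λ h → subst₂ _~_ (p-to x) (p-to y) (edge (to x) (to y) h))

  -- Outer neighbours of a triangle are primed; they are distinct exactly because the
  -- triangle shares no edge with another triangle.
  record Tri (x y z x′ y′ z′ : Fin n) : Set where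
    no-eta-equality
    field
      nx : Nbrs x y z x′
      ny : Nbrs y z x y′
      nz : Nbrs z x y z′
      x′≢y′ : x′ ≢ y′
      y′≢z′ : y′ ≢ z′
      z′≢x′ : z′ ≢ x′
  open Tri

  -- A diamond with ends a, b; a′ and b′ are the neighbours of the ends outside it.
  record Dia (a b c d a′ b′ : Fin n) : Set where
    no-eta-equality
    field
      na : Nbrs a c d a′
      nb : Nbrs b c d b′
      nc : Nbrs c a b d
      nd : Nbrs d a b c
      a′≢b : a′ ≢ b
      b′≢a : b′ ≢ a
  open Dia

  IsTri IsEnd IsMid InDia : Fin n → Set
  IsTri v = ∃[ y ] ∃[ z ] ∃[ v′ ] ∃[ y′ ] ∃[ z′ ] Tri v y z v′ y′ z′
  IsEnd v = ∃[ b ] ∃[ c ] ∃[ d ] ∃[ v′ ] ∃[ b′ ] Dia v b c d v′ b′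
  IsMid v = ∃[ a ] ∃[ b ] ∃[ d ] ∃[ a′ ] ∃[ b′ ] Dia a b v d a′ b′
  InDia v = IsEnd v ⊎ IsMid v

  tri-rot : Tri x y z x′ y′ z′ → Tri y z x y′ z′ x′
  tri-rot t = record { nx = ny t ; ny = nz t ; nz = nx t
                     ; x′≢y′ = y′≢z′ t ; y′≢z′ = z′≢x′ t ; z′≢x′ = x′≢y′ t }

  tri-swp : Tri x y z x′ y′ z′ → Tri x z y x′ z′ y′
  tri-swp t = record
    { nx = flp (nx t) ; ny = flp (nz t)
    ; nz = flp (ny t)
    ; x′≢y′ = z′≢x′ t ∘ sym ; y′≢z′ = y′≢z′ t ∘ sym ; z′≢x′ = x′≢y′ t ∘ sym }

  dia-flip : Dia a b c d a′ b′ → Dia b a c d b′ a′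
  dia-flip D = record { na = nb D ; nb = na D ; nc = flp (nc D)
                      ; nd = flp (nd D)
                      ; a′≢b = b′≢a D ; b′≢a = a′≢b D }

  dia-swp : Dia a b c d a′ b′ → Dia a b d c a′ b′
  dia-swp D = record { na = flp (na D) ; nb = flp (nb D)
                     ; nc = nd D ; nd = nc D ; a′≢b = a′≢b D ; b′≢a = b′≢a D }

  -- The edge uv lies in a triangle; the remaining edges are the outer ones.
  M : Fin n → Fin n → Set
  M u v = u ~ v × ∃[ w ] (u ~ w × v ~ w)

  M-sym : M u v → M v u
  M-sym (e , w , uw , vw) = ~-sym e , w , vw , uw

  tri-M-y : Tri x y z x′ y′ z′ → M x y
  tri-M-y t = p~ (nx t) , _ , q~ (nx t) , p~ (ny t)

  tri-M-z : Tri x y z x′ y′ z′ → M x z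
  tri-M-z t = tri-M-y (tri-swp t)

  -- If `x x′` were in a triangle, its third vertex would be `y` or `z`, and `x′` would also be the
  -- outer neighbour of that vertex.
  tri-M : Tri x y z x′ y′ z′ → M x v → v ≡ y ⊎ v ≡ z
  tri-M t (xv , w , xw , vw) with only (nx t) xv
  ... | inj₁ v≡y = inj₁ v≡y
  ... | inj₂ (inj₁ v≡z) = inj₂ v≡z
  ... | inj₂ (inj₂ refl) with only (nx t) xw
  ...   | inj₂ (inj₂ refl) = contradiction refl (~⇒≢ vw)
  ...   | inj₁ refl = ⊥-elim ([ q≢r (nx t) ∘ sym , [ ~⇒≢ xv ∘ sym , x′≢y′ t ]′ ]′ (only (ny t) (~-sym vw)))
  ...   | inj₂ (inj₁ refl) =
          ⊥-elim ([ ~⇒≢ xv ∘ sym , [ p≢r (nx t) ∘ sym , z′≢x′ t ∘ sym ]′ ]′ (only (nz t) (~-sym vw)))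

  -- A triangle on `a a′` would have `c` or `d` as third vertex, but all neighbours of these are in
  -- the diamond.
  end-M : Dia a b c d a′ b′ → M a v → v ≡ c ⊎ v ≡ d
  end-M D (av , w , aw , vw) with only (na D) av
  ... | inj₁ v≡c = inj₁ v≡c
  ... | inj₂ (inj₁ v≡d) = inj₂ v≡d
  ... | inj₂ (inj₂ refl) with only (na D) aw
  ...   | inj₂ (inj₂ refl) = contradiction refl (~⇒≢ vw)
  ...   | inj₁ refl = ⊥-elim ([ ~⇒≢ av ∘ sym , [ a′≢b D , q≢r (na D) ∘ sym ]′ ]′ (only (nc D) (~-sym vw)))
  ...   | inj₂ (inj₁ refl) = ⊥-elim ([ ~⇒≢ av ∘ sym , [ a′≢b D , p≢r (na D) ∘ sym ]′ ]′ (only (nd D) (~-sym vw)))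

  dia-M-ac : Dia a b c d a′ b′ → M a c
  dia-M-ac D = p~ (na D) , _ , q~ (na D) , r~ (nc D)

  dia-M-cd : Dia a b c d a′ b′ → M c d
  dia-M-cd D = r~ (nc D) , _ , p~ (nc D) , p~ (nd D)

  mid-M : Dia a b c d a′ b′ → c ~ v → M c v
  mid-M D e with only (nc D) e
  ... | inj₁ refl        = M-sym (dia-M-ac D)
  ... | inj₂ (inj₁ refl) = M-sym (dia-M-ac (dia-flip D))
  ... | inj₂ (inj₂ refl) = dia-M-cd D

  tri-outer : Tri x y z x′ y′ z′ → ¬ M x x′
  tri-outer t h = [ p≢r (nx t) ∘ sym , q≢r (nx t) ∘ sym ]′ (tri-M t h)

  end-outer : Dia a b c d a′ b′ → ¬ M a a′
  end-outer D h = [ p≢r (na D) ∘ sym , q≢r (na D) ∘ sym ]′ (end-M D h)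

  -- By `tri-M` the middle vertices would be `y` and `z`; then `b` would be the outer neighbour of
  -- both, against `y′≢z′`.
  tri-not-end : IsTri v → ¬ IsEnd v
  tri-not-end (y , z , _ , _ , _ , t) (b , c , d , _ , _ , D) =
    go t D (tri-M t (dia-M-ac D)) (tri-M t (dia-M-ac (dia-swp D)))
    where
    core : Tri v y z x′ y′ z′ → Dia v b y z a′ b′ → ⊥
    core t D with only (ny t) (q~ (nc D)) | only (nz t) (q~ (nd D))
    ... | inj₁ refl | _ = ~⇒≢ (q~ (nb D)) refl
    ... | inj₂ (inj₁ refl) | _ = p≢q (nc D) refl
    ... | inj₂ (inj₂ refl) | inj₁ refl = p≢q (nc D) refl
    ... | inj₂ (inj₂ refl) | inj₂ (inj₁ refl) = ~⇒≢ (p~ (nb D)) refl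
    ... | inj₂ (inj₂ refl) | inj₂ (inj₂ eq) = y′≢z′ t eq
    go : Tri v y z x′ y′ z′ → Dia v b c d a′ b′ → c ≡ y ⊎ c ≡ z → d ≡ y ⊎ d ≡ z → ⊥
    go t D (inj₁ refl) (inj₁ refl) = r≢ D refl
      where r≢ : Dia a b c d a′ b′ → c ≢ d
            r≢ D = p≢q (na D)
    go t D (inj₁ refl) (inj₂ refl) = core t D
    go t D (inj₂ refl) (inj₁ refl) = core t (dia-swp D)
    go t D (inj₂ refl) (inj₂ refl) = p≢q (na D) refl

  -- At a middle vertex all three edges lie in triangles, at a triangle vertex only two.
  tri-not-mid : IsTri v → ¬ IsMid v
  tri-not-mid (_ , _ , _ , _ , _ , t) (_ , _ , _ , _ , _ , D)
    with tri-M t (mid-M D (p~ (nc D))) | tri-M t (mid-M D (q~ (nc D))) | tri-M t (mid-M D (r~ (nc D)))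
  ... | inj₁ refl | inj₁ refl | _ = p≢q (nc D) refl
  ... | inj₁ refl | inj₂ refl | inj₁ refl = p≢r (nc D) refl
  ... | inj₁ refl | inj₂ refl | inj₂ refl = q≢r (nc D) refl
  ... | inj₂ refl | inj₁ refl | inj₁ refl = q≢r (nc D) refl
  ... | inj₂ refl | inj₁ refl | inj₂ refl = p≢r (nc D) refl
  ... | inj₂ refl | inj₂ refl | _ = p≢q (nc D) refl

  tri-not-dia : IsTri v → ¬ InDia v
  tri-not-dia t = [ tri-not-end t , tri-not-mid t ]′

  -- Classification of the vertices

  mkDia : a ≢ b → ¬ a ~ b → a ~ c → a ~ d → b ~ c → b ~ d → c ~ d →
          ∃[ a′ ] ∃[ b′ ] Dia a b c d a′ b′
  mkDia {a} {b} {c} {d} a≢b a≁b ac ad bc bd cd = _ , _ , record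
    { na = Na ; nb = Nb
    ; nc = mkNbrs (~-sym ac) (~-sym bc) cd a≢b (~⇒≢ ad) (~⇒≢ bd)
    ; nd = mkNbrs (~-sym ad) (~-sym bd) (~-sym cd) a≢b (~⇒≢ ac) (~⇒≢ bc)
    ; a′≢b = λ { refl → a≁b (r~ Na) } ; b′≢a = λ { refl → a≁b (~-sym (r~ Nb)) } }
    where
    Na = proj₂ (third ac ad (~⇒≢ cd))
    Nb = proj₂ (third bc bd (~⇒≢ cd))

  -- Within these four vertices every degree is already 3, so connectedness makes them the whole
  -- graph, which would be `K4`.
  complete-four : Nbrs v x y z → x ~ y → x ~ z → y ~ z → ⊥
  complete-four {v} {x} {y} {z} N xy xz yz =
    G≇K4 (mkIso pt (lookup-injective distinct) zero nbr edge)
    where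
    vs : List (Fin n)
    vs = v ∷ x ∷ y ∷ z ∷ []
    distinct : Unique vs
    distinct = (~⇒≢ (p~ N) ∷ ~⇒≢ (q~ N) ∷ ~⇒≢ (r~ N) ∷ []) ∷
               (p≢q N ∷ p≢r N ∷ []) ∷ (q≢r N ∷ []) ∷ [] ∷ []
    pt : Fin 4 → Fin n
    pt = lookup vs
    Nx : Nbrs x v y z
    Nx = mkNbrs (~-sym (p~ N)) xy xz (~⇒≢ (q~ N)) (~⇒≢ (r~ N)) (q≢r N)
    Ny : Nbrs y v x z
    Ny = mkNbrs (~-sym (q~ N)) (~-sym xy) yz (~⇒≢ (p~ N)) (~⇒≢ (r~ N)) (p≢r N)
    Nz : Nbrs z v x y
    Nz = mkNbrs (~-sym (r~ N)) (~-sym xz) (~-sym yz) (~⇒≢ (p~ N)) (~⇒≢ (q~ N)) (p≢q N)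
    nbr : ∀ s {w} → pt s ~ w → ∃[ t ] (pt t ≡ w × T (K4 s t))
    nbr zero e with only N e
    ... | inj₁ eq = suc zero , sym eq , tt
    ... | inj₂ (inj₁ eq) = suc (suc zero) , sym eq , tt
    ... | inj₂ (inj₂ eq) = suc (suc (suc zero)) , sym eq , tt
    nbr (suc zero) e with only Nx e
    ... | inj₁ eq = zero , sym eq , tt
    ... | inj₂ (inj₁ eq) = suc (suc zero) , sym eq , tt
    ... | inj₂ (inj₂ eq) = suc (suc (suc zero)) , sym eq , tt
    nbr (suc (suc zero)) e with only Ny e
    ... | inj₁ eq = zero , sym eq , tt
    ... | inj₂ (inj₁ eq) = suc zero , sym eq , tt
    ... | inj₂ (inj₂ eq) = suc (suc (suc zero)) , sym eq , tt
    nbr (suc (suc (suc zero))) e with only Nz e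
    ... | inj₁ eq = zero , sym eq , tt
    ... | inj₂ (inj₁ eq) = suc zero , sym eq , tt
    ... | inj₂ (inj₂ eq) = suc (suc zero) , sym eq , tt
    edge : ∀ s t → T (K4 s t) → pt s ~ pt t
    edge zero (suc zero) _ = p~ N
    edge zero (suc (suc zero)) _ = q~ N
    edge zero (suc (suc (suc zero))) _ = r~ N
    edge (suc zero) zero _ = p~ Nx
    edge (suc zero) (suc (suc zero)) _ = xy
    edge (suc zero) (suc (suc (suc zero))) _ = xz
    edge (suc (suc zero)) zero _ = p~ Ny
    edge (suc (suc zero)) (suc zero) _ = q~ Ny
    edge (suc (suc zero)) (suc (suc (suc zero))) _ = yz
    edge (suc (suc (suc zero))) zero _ = p~ Nz
    edge (suc (suc (suc zero))) (suc zero) _ = q~ Nz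
    edge (suc (suc (suc zero))) (suc (suc zero)) _ = r~ Nz
    edge (suc (suc (suc zero))) (suc (suc (suc zero))) ()

  -- The cases are the edges that the triangle `v x y` may share with another triangle: with `v x`
  -- or `v y` shared, `v` is in the middle of a diamond; with `x y` shared, it is an end; with none,
  -- the triangle is a unit of its own.
  kind′ : Nbrs v x y z → x ~ y → IsTri v ⊎ InDia v
  kind′ {v} {x} {y} {z} N xy with T? (G x z) | T? (G y z)
  ... | yes xz | yes yz = ⊥-elim (complete-four N xy xz yz)
  ... | yes xz | no y≁z = inj₂ (inj₂ (_ , _ , _ , _ , _ , proj₂ (proj₂
          (mkDia (q≢r N) y≁z (~-sym (q~ N)) (~-sym xy) (~-sym (r~ N)) (~-sym xz) (p~ N)))))
  ... | no x≁z | yes yz = inj₂ (inj₂ (_ , _ , _ , _ , _ , proj₂ (proj₂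
          (mkDia (p≢r N) x≁z (~-sym (p~ N)) xy (~-sym (r~ N)) (~-sym yz) (q~ N)))))
  ... | no x≁z | no y≁z = go (third (~-sym (p~ N)) xy (~⇒≢ (q~ N))) (third (~-sym (q~ N)) (~-sym xy) (~⇒≢ (p~ N)))
    where
    go : ∃[ x′ ] Nbrs x v y x′ → ∃[ y′ ] Nbrs y v x y′ → IsTri v ⊎ InDia v
    go (x′ , Nx) (y′ , Ny) with x′ ≟ y′
    ... | no x′≢y′ = inj₁ (_ , _ , _ , _ , _ , record
      { nx = N ; ny = flp Nx ; nz = Ny
      ; x′≢y′ = λ { refl → x≁z (r~ Nx) } ; y′≢z′ = x′≢y′ ; z′≢x′ = λ { refl → y≁z (r~ Ny) } })
    ... | yes refl = inj₂ (inj₁ (_ , _ , _ , _ , _ , proj₂ (proj₂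
      (mkDia (p≢r Nx) v≁x′ (p~ N) (q~ N) (~-sym (r~ Nx)) (~-sym (r~ Ny)) xy))))
      where
      v≁x′ : ¬ v ~ x′
      v≁x′ e with only N e
      ... | inj₁ refl = ~⇒≢ (r~ Nx) refl
      ... | inj₂ (inj₁ refl) = q≢r Nx refl
      ... | inj₂ (inj₂ refl) = x≁z (r~ Nx)

  kind-of : Nbrs v x y z → IsTri v ⊎ InDia v
  kind-of {v} {x} {y} {z} N with T? (G x y) | T? (G x z) | T? (G y z)
  ... | yes xy | _ | _ = kind′ N xy
  ... | no _ | yes xz | _ = kind′ (swp N) xz
  ... | no _ | no _ | yes yz = kind′ (rot N) yz
  ... | no x≁y | no x≁z | no y≁z =
    ⊥-elim (clawFree v x y z (p~ N) (q~ N) (r~ N) (p≢q N) (p≢r N) (q≢r N)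
      (¬T⇒false x≁y) (¬T⇒false x≁z) (¬T⇒false y≁z))
    where
    ¬T⇒false : ∀ {b} → ¬ T b → b ≡ false
    ¬T⇒false {false} _ = refl
    ¬T⇒false {true} h = ⊥-elim (h tt)

  abstract
    kind : ∀ v → IsTri v ⊎ InDia v
    kind v = kind-of (proj₂ (proj₂ (proj₂ (threeNbrs v))))

  tri-outer-only : Tri x y z x′ y′ z′ → x ~ v → ¬ M x v → v ≡ x′
  tri-outer-only t e h with only (nx t) e
  ... | inj₁ refl = contradiction (tri-M-y t) h
  ... | inj₂ (inj₁ refl) = contradiction (tri-M-z t) h
  ... | inj₂ (inj₂ eq) = eq

  end-outer-only : Dia a b c d a′ b′ → a ~ v → ¬ M a v → v ≡ a′
  end-outer-only D e h with only (na D) e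
  ... | inj₁ refl = contradiction (dia-M-ac D) h
  ... | inj₂ (inj₁ refl) = contradiction (dia-M-ac (dia-swp D)) h
  ... | inj₂ (inj₂ eq) = eq

  -- There is one outer edge at a triangle vertex and at an end of a diamond, and none at a middle
  -- vertex.
  outer-unique : v ~ x → ¬ M v x → v ~ y → ¬ M v y → x ≡ y
  outer-unique {v} vx mx vy my with kind v
  ... | inj₁ (_ , _ , _ , _ , _ , t) = trans (tri-outer-only t vx mx) (sym (tri-outer-only t vy my))
  ... | inj₂ (inj₁ (_ , _ , _ , _ , _ , D)) = trans (end-outer-only D vx mx) (sym (end-outer-only D vy my))
  ... | inj₂ (inj₂ (_ , _ , _ , _ , _ , D)) = contradiction (mid-M D vx) mx

  -- Growing a coloured set

  tri≢dia : IsTri x → InDia y → x ≢ y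
  tri≢dia t D refl = tri-not-dia t D

  tri₁ : Tri x y z x′ y′ z′ → IsTri x
  tri₁ t = _ , _ , _ , _ , _ , t

  tri₂ : Tri x y z x′ y′ z′ → IsTri y
  tri₂ t = tri₁ (tri-rot t)

  tri₃ : Tri x y z x′ y′ z′ → IsTri z
  tri₃ t = tri₂ (tri-rot t)

  dia-vertices : Dia a b c d a′ b′ → All InDia (a ∷ b ∷ c ∷ d ∷ [])
  dia-vertices D = inj₁ (_ , _ , _ , _ , _ , D) ∷ inj₁ (_ , _ , _ , _ , _ , dia-flip D) ∷
    inj₂ (_ , _ , _ , _ , _ , D) ∷ inj₂ (_ , _ , _ , _ , _ , dia-swp D) ∷ []

  dia-unique : Dia a b c d a′ b′ → Unique (a ∷ b ∷ c ∷ d ∷ [])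
  dia-unique D = (p≢q (nc D) ∷ ~⇒≢ (p~ (na D)) ∷ ~⇒≢ (q~ (na D)) ∷ []) ∷
    (~⇒≢ (p~ (nb D)) ∷ ~⇒≢ (q~ (nb D)) ∷ []) ∷ (p≢q (na D) ∷ []) ∷ [] ∷ []

  not-mid-outer : v ~ u → ¬ M v u → ¬ IsMid v
  not-mid-outer e h (_ , _ , _ , _ , _ , D) = h (mid-M D e)

  forceN : Nbrs v p q r → Colored G F v → Colored G F p → Colored G F q → Colored G F r
  forceN N cv cp cq = force cv (r~ N) λ x e x≢r → other x (only N e) x≢r
    where
    other : ∀ x → x ≡ _ ⊎ x ≡ _ ⊎ x ≡ _ → x ≢ _ → Colored G _ x
    other x (inj₁ refl) _ = cp
    other x (inj₂ (inj₁ refl)) _ = cq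
    other x (inj₂ (inj₂ eq)) ne = contradiction eq ne

  -- A `Full` vertex can force across its outer edge. An `Entered` vertex is in a triangle and has
  -- its outer neighbour in `E`, so it forces the last vertex of its triangle once the other one is
  -- coloured. Diamond vertices can only be `Full`.
  Full Entered Settled : VSet n → Fin n → Set
  Full E u    = ∀ {v} → M u v → v ∈ E
  Entered E u = ¬ InDia u × (∀ {v} → u ~ v → ¬ M u v → v ∈ E)
  Settled E u = Full E u ⊎ Entered E u

  Settled-mono : (∀ {v} → v ∈ E → v ∈ F) → Settled E u → Settled F u
  Settled-mono h (inj₁ f)       = inj₁ λ m → h (f m)
  Settled-mono h (inj₂ (i , f)) = inj₂ (i , λ e m → h (f e m))

  settled-tri : Tri x y z x′ y′ z′ → y ∈ E → z ∈ E → Settled E x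
  settled-tri t y∈ z∈ = inj₁ λ m → [ (λ { refl → y∈ }) , (λ { refl → z∈ }) ]′ (tri-M t m)

  settled-entered : IsTri x → x ~ v → ¬ M x v → v ∈ E → Settled E x
  settled-entered {E = E} t xv ¬m v∈ =
    inj₂ (tri-not-dia t , λ e h → subst (_∈ E) (outer-unique xv ¬m e h) v∈)

  settled-dia : Dia a b c d a′ b′ → All (_∈ E) (a ∷ b ∷ c ∷ d ∷ []) → All (Settled E) (a ∷ b ∷ c ∷ d ∷ [])
  settled-dia {E = E} D (a∈ ∷ b∈ ∷ c∈ ∷ d∈ ∷ []) =
    end D c∈ d∈ ∷ end (dia-flip D) c∈ d∈ ∷ mid D a∈ b∈ d∈ ∷ mid (dia-swp D) a∈ b∈ c∈ ∷ []
    where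
    end : Dia a b c d a′ b′ → c ∈ E → d ∈ E → Settled E a
    end D c∈ d∈ = inj₁ λ m → [ (λ { refl → c∈ }) , (λ { refl → d∈ }) ]′ (end-M D m)
    mid : Dia a b c d a′ b′ → a ∈ E → b ∈ E → d ∈ E → Settled E c
    mid D a∈ b∈ d∈ = inj₁ λ (e , _) →
      [ (λ { refl → a∈ }) , [ (λ { refl → b∈ }) , (λ { refl → d∈ }) ]′ ]′ (only (nc D) e)

  Supported : VSet n → Fin n → Set
  Supported S v = ∃[ u ] (u ∈ S × v ~ u)

  -- E consists of coloured vertices that have been paid for. A coloured end of a diamond is
  -- not put into E before the rest of its diamond, so that a later move can pay for two
  -- new vertices of S by the four vertices of the diamond.
  record State (φ : ℕ) (E : VSet n) : Set where
    field
      S       : VSet n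
      total   : ∀ v → v ∈ S → Supported S v
      colored : ∀ {v} → v ∈ E → Colored G S v
      settled : ∀ {v} → v ∈ E → Settled E v
      bound   : 2 * count S + φ ≤ count E

  -- Moves and their cost

  branch-unique : Tri u p q x′ y′ z′ → Unique (p ∷ q ∷ y′ ∷ z′ ∷ [])
  branch-unique t = (p≢q (nx t) ∷ ~⇒≢ (r~ (ny t)) ∷ q≢r (nz t) ∷ []) ∷
    (p≢r (ny t) ∷ ~⇒≢ (r~ (nz t)) ∷ []) ∷ (y′≢z′ t ∷ []) ∷ [] ∷ []

  branch-dia-unique : Tri u p q x′ y′ z′ → Dia a b c d a′ b′ → Unique (p ∷ q ∷ a ∷ b ∷ c ∷ d ∷ [])
  branch-dia-unique t D = (p≢q (nx t) ∷ All.map (tri≢dia (tri₂ t)) (dia-vertices D)) ∷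
    All.map (tri≢dia (tri₃ t)) (dia-vertices D) ∷ dia-unique D

  module _ {φ : ℕ} (σ : State φ E) where
    open State σ renaming (S to S₀)

    old : ∀ ys → v ∈ E → Colored G (S₀ ⊕ ys) v
    old ys v∈ = Colored-mono (λ _ → ∈⊕ʳ ys) (colored v∈)

    -- The accounting of every move: `ys` joins `S`, `xs` joins `E`, and `g` is the surplus of the
    -- move over two new coloured vertices per vertex paid. Older conditions persist because
    -- colouring, support and being settled are monotone.
    extend : ∀ xs ys → Unique xs → All (_∉ E) xs → All (Supported (S₀ ⊕ ys)) ys →
             All (Colored G (S₀ ⊕ ys)) xs → All (Settled (E ⊕ xs)) xs →
             ∀ g → 2 * length ys + g ≤ length xs → State (g + φ) (E ⊕ xs)
    extend xs ys uniq fresh supp col sett g h = record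
      { S = S₀ ⊕ ys
      ; total = λ v v∈ → [ All.lookup supp
                         , (λ v∈S → let (u , u∈ , e) = total v v∈S in u , ∈⊕ʳ ys u∈ , e) ]′ (∈⊕⁻ S₀ ys v∈)
      ; colored = λ v∈ → [ All.lookup col , old ys ]′ (∈⊕⁻ E xs v∈)
      ; settled = λ v∈ → [ All.lookup sett , Settled-mono (∈⊕ʳ xs) ∘ settled ]′ (∈⊕⁻ E xs v∈)
      ; bound = begin
          2 * count (S₀ ⊕ ys) + (g + φ)            ≤⟨ +-monoˡ-≤ (g + φ) (*-monoʳ-≤ 2 (count-⊕≤ S₀ ys)) ⟩
          2 * (length ys + count S₀) + (g + φ)     ≡⟨ rearrange (length ys) (count S₀) g φ ⟩
          (2 * length ys + g) + (2 * count S₀ + φ) ≤⟨ +-mono-≤ h bound ⟩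
          length xs + count E                      ≡⟨ count-⊕ E uniq fresh ⟨
          count (E ⊕ xs)                           ∎ }
      where
      open ≤-Reasoning
      rearrange : ∀ l s g φ → 2 * (l + s) + (g + φ) ≡ (2 * l + g) + (2 * s + φ)
      rearrange = solve-∀

    full : u ∈ E → v ∉ E → u ~ v → ¬ M u v → Full E u
    full u∈ v∉ e ¬m with settled u∈
    ... | inj₁ f       = f
    ... | inj₂ (_ , f) = contradiction (f e ¬m) v∉

    full-dia : InDia u → u ∈ E → Full E u
    full-dia D u∈ with settled u∈
    ... | inj₁ f       = f
    ... | inj₂ (¬D , _) = contradiction D ¬D

    -- Diamond vertices in `E` are `Full`, and edges in triangles connect the diamond, so any vertex
    -- of it in `E` would bring in `a`.
    dia-outside : Dia a b c d a′ b′ → a ∉ E → All (_∉ E) (a ∷ b ∷ c ∷ d ∷ [])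
    dia-outside D a∉ with dia-vertices D
    ... | _ ∷ D-b ∷ D-c ∷ D-d ∷ [] = a∉
      ∷ (λ b∈ → c∉ (full-dia D-b b∈ (dia-M-ac (dia-flip D)))) ∷ c∉
      ∷ (λ d∈ → a∉ (full-dia D-d d∈ (M-sym (dia-M-ac (dia-swp D))))) ∷ []
      where
      c∉ : _ ∉ E
      c∉ c∈ = a∉ (full-dia D-c c∈ (M-sym (dia-M-ac D)))

    -- As `v` is outside `E`, the vertex `u` is `Full`: its two other neighbours are coloured and it
    -- forces `v`.
    outer-colored : u ∈ E → v ∉ E → u ~ v → ¬ M u v → Colored G S₀ v
    outer-colored {u} u∈ v∉ e ¬m with kind u | full u∈ v∉ e ¬m
    ... | inj₁ (_ , _ , _ , _ , _ , t) | f with tri-outer-only t e ¬m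
    ...   | refl = forceN (nx t) (colored u∈) (colored (f (tri-M-y t))) (colored (f (tri-M-z t)))
    outer-colored {u} u∈ v∉ e ¬m | inj₂ (inj₁ (_ , _ , _ , _ , _ , D)) | f with end-outer-only D e ¬m
    ...   | refl = forceN (na D) (colored u∈) (colored (f (dia-M-ac D))) (colored (f (dia-M-ac (dia-swp D))))
    outer-colored {u} u∈ v∉ e ¬m | inj₂ (inj₂ m) | f = ⊥-elim (not-mid-outer e ¬m m)

    -- Nothing joins `S`: `v` is forced by `u`, and `u` also makes it `Entered`.
    gain-tri : u ∈ E → v ∉ E → u ~ v → ¬ M u v → IsTri v → State (suc φ) (E ⊕ (v ∷ []))
    gain-tri {v = v} u∈ v∉ e ¬m t = extend (v ∷ []) [] ([] ∷ []) (v∉ ∷ []) []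
      (Colored-mono (λ _ → ∈⊕ʳ []) (outer-colored u∈ v∉ e ¬m) ∷ [])
      (settled-entered t (~-sym e) (¬m ∘ M-sym) (∈⊕ʳ (v ∷ []) u∈) ∷ []) 1 (s≤s z≤n)

    -- With `y` outside, `x` is not `Full`; hence its outer neighbour is in `E`, and `x` forces `y`
    -- for free.
    gain-third : Tri x y z x′ y′ z′ → x ∈ E → z ∈ E → y ∉ E → State (suc φ) (E ⊕ (y ∷ []))
    gain-third {y = y} t x∈ z∈ y∉ = extend (y ∷ []) [] ([] ∷ []) (y∉ ∷ []) []
      (Colored-mono (λ _ → ∈⊕ʳ []) (col (settled x∈)) ∷ [])
      (settled-tri (tri-rot t) (∈⊕ʳ (y ∷ []) z∈) (∈⊕ʳ (y ∷ []) x∈) ∷ []) 1 (s≤s z≤n)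
      where
      col : Settled E _ → Colored G S₀ y
      col (inj₁ f) = contradiction (f (tri-M-y t)) y∉
      col (inj₂ (_ , f)) = forceN (rot (nx t)) (colored x∈) (colored z∈)
        (colored (f (r~ (nx t)) (tri-outer t)))

    -- `u` forces `a`; the middle vertices join `S`, support each other, and `c` forces `b`: two for
    -- four.
    add-dia : u ∈ E → u ~ a → ¬ M u a → Dia a b c d a′ b′ → a ∉ E → State φ (E ⊕ (a ∷ b ∷ c ∷ d ∷ []))
    add-dia {a = a} {b} {c} {d} u∈ e ¬m D a∉ =
      extend (a ∷ b ∷ c ∷ d ∷ []) (c ∷ d ∷ []) (dia-unique D) (dia-outside D a∉)
        ((d , ∈⊕ˡ (thereˡ (hereˡ refl)) , r~ (nc D)) ∷ (c , ∈⊕ˡ (hereˡ refl) , r~ (nd D)) ∷ [])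
        (ca ∷ forceN (swp (nc D)) cc ca cd ∷ cc ∷ cd ∷ [])
        (settled-dia D (All.tabulate ∈⊕ˡ)) 0 ≤-refl
      where
      ca = Colored-mono (λ _ → ∈⊕ʳ (c ∷ d ∷ [])) (outer-colored u∈ a∉ e ¬m)
      cc : Colored G (S₀ ⊕ (c ∷ d ∷ [])) c
      cc = init (∈⊕ˡ (hereˡ refl))
      cd : Colored G (S₀ ⊕ (c ∷ d ∷ [])) d
      cd = init (∈⊕ˡ (thereˡ (hereˡ refl)))

    -- `p` and `q` join `S`, support each other, and force `y′` and `z′`, which become `Entered`:
    -- two for four.
    add-branch : Tri u p q x′ y′ z′ → u ∈ E → All (_∉ E) (p ∷ q ∷ y′ ∷ z′ ∷ []) → IsTri y′ → IsTri z′ →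
                 State φ (E ⊕ (p ∷ q ∷ y′ ∷ z′ ∷ []))
    add-branch {p = p} {q} {y′ = y′} {z′} t u∈ fresh ty tz =
      extend xs (p ∷ q ∷ []) (branch-unique t) fresh
        ((q , ∈⊕ˡ (thereˡ (hereˡ refl)) , p~ (ny t)) ∷ (p , ∈⊕ˡ (hereˡ refl) , q~ (nz t)) ∷ [])
        (cp ∷ cq ∷ forceN (ny t) cp cq cu ∷ forceN (nz t) cq cu cp ∷ [])
        (settled-tri (tri-rot t) q∈ u∈′ ∷ settled-tri (tri-rot (tri-rot t)) u∈′ p∈ ∷
         settled-entered ty (~-sym (r~ (ny t))) (tri-outer (tri-rot t) ∘ M-sym) p∈ ∷
         settled-entered tz (~-sym (r~ (nz t))) (tri-outer (tri-rot (tri-rot t)) ∘ M-sym) q∈ ∷ [])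
        0 ≤-refl
      where
      xs = p ∷ q ∷ y′ ∷ z′ ∷ []
      p∈ : p ∈ E ⊕ xs
      p∈ = ∈⊕ˡ (hereˡ refl)
      q∈ : q ∈ E ⊕ xs
      q∈ = ∈⊕ˡ (thereˡ (hereˡ refl))
      u∈′ = ∈⊕ʳ xs u∈
      cu = old (p ∷ q ∷ []) u∈
      cp : Colored G (S₀ ⊕ (p ∷ q ∷ [])) p
      cp = init (∈⊕ˡ (hereˡ refl))
      cq : Colored G (S₀ ⊕ (p ∷ q ∷ [])) q
      cq = init (∈⊕ˡ (thereˡ (hereˡ refl)))

    -- The path `p a c` joins `S`. Then `u` forces `q`, `a` forces `d` and `c` forces `b`: three for
    -- six.
    add-branch-dia : Tri u p q x′ a z′ → Dia a b c d p b′ → u ∈ E → x′ ∈ E → p ∉ E → q ∉ E → a ∉ E →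
                     State φ (E ⊕ (p ∷ q ∷ a ∷ b ∷ c ∷ d ∷ []))
    add-branch-dia {u} {p} {q} {a = a} {b = b} {c = c} {d = d} t D u∈ x′∈ p∉ q∉ a∉ =
      extend xs ys (branch-dia-unique t D) (p∉ ∷ q∉ ∷ dia-outside D a∉)
        ((a , ∈⊕ˡ (thereˡ (hereˡ refl)) , r~ (ny t)) ∷
         (p , ∈⊕ˡ (hereˡ refl) , r~ (na D)) ∷
         (a , ∈⊕ˡ (thereˡ (hereˡ refl)) , p~ (nc D)) ∷ [])
        (cp ∷ forceN (swp (nx t)) (old ys u∈) cp (old ys x′∈) ∷ ca ∷ forceN (swp (nc D)) cc ca cd ∷ cc ∷ cd ∷ [])
        (settled-tri (tri-rot t) (∈⊕ˡ (thereˡ (hereˡ refl))) (∈⊕ʳ xs u∈) ∷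
         settled-tri (tri-rot (tri-rot t)) (∈⊕ʳ xs u∈) (∈⊕ˡ (hereˡ refl)) ∷
         settled-dia D (All.tabulate λ i → ∈⊕ˡ (thereˡ (thereˡ i))))
        0 ≤-refl
      where
      xs = p ∷ q ∷ a ∷ b ∷ c ∷ d ∷ []
      ys = p ∷ a ∷ c ∷ []
      cp : Colored G (S₀ ⊕ ys) p
      cp = init (∈⊕ˡ (hereˡ refl))
      ca : Colored G (S₀ ⊕ ys) a
      ca = init (∈⊕ˡ (thereˡ (hereˡ refl)))
      cc : Colored G (S₀ ⊕ ys) c
      cc = init (∈⊕ˡ (thereˡ (thereˡ (hereˡ refl))))
      cd = forceN (swp (na D)) ca cc cp

  -- Choosing a move at the boundary

  grow< : ∀ {xs} → Unique (x ∷ xs) → All (_∉ E) (x ∷ xs) → count E < count (E ⊕ (x ∷ xs))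
  grow< {E = E} {xs = xs} uniq fresh =
    subst (count E <_) (sym (count-⊕ E uniq fresh)) (s≤s (m≤n+m _ (length xs)))

  -- `branch` describes a move not yet made, since `branching` may replace it by a gain or by
  -- `double-edge`. The vertex in `dia` lets that case be refuted in graphs without diamonds.
  data Step (φ : ℕ) (E : VSet n) : Set where
    gain   : State (suc φ) F → count E < count F → Step φ E
    dia    : InDia v → State φ F → count E < count F → Step φ E
    branch : Tri u p q x′ y′ z′ → u ∈ E → All (_∉ E) (p ∷ q ∷ y′ ∷ z′ ∷ []) → IsTri y′ → IsTri z′ → Step φ E

  module _ {φ : ℕ} (σ : State φ E) where
    -- If one of `q`, `y′`, `z′` is already in `E`, it leads to a free vertex of the triangle.
    -- Otherwise a diamond end among `y′`, `z′` gives a three for six move, and two triangle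
    -- vertices give a branch.
    step-branch : Tri u p q x′ y′ z′ → u ∈ E → x′ ∈ E → p ∉ E → Step φ E
    step-branch {q = q} {y′ = y′} {z′} t u∈ x′∈ p∉ with q ∈? E
    ... | yes q∈ = gain (gain-third σ t u∈ q∈ p∉) (grow< ([] ∷ []) (p∉ ∷ []))
    ... | no q∉ with y′ ∈? E
    ...   | yes y′∈ = gain (gain-tri σ y′∈ p∉ (~-sym (r~ (ny t))) (tri-outer (tri-rot t) ∘ M-sym) (tri₂ t))
                        (grow< ([] ∷ []) (p∉ ∷ []))
    ...   | no y′∉ with z′ ∈? E
    ...     | yes z′∈ = gain (gain-tri σ z′∈ q∉ (~-sym (r~ (nz t))) (tri-outer (tri-rot (tri-rot t)) ∘ M-sym) (tri₃ t))
                          (grow< ([] ∷ []) (q∉ ∷ []))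
    ...     | no z′∉ = go (kind y′) (kind z′)
      where
      go : IsTri y′ ⊎ InDia y′ → IsTri z′ ⊎ InDia z′ → Step φ E
      go (inj₁ ty) (inj₁ tz) = branch t u∈ (p∉ ∷ q∉ ∷ y′∉ ∷ z′∉ ∷ []) ty tz
      go (inj₂ (inj₂ m)) _ = ⊥-elim (not-mid-outer (~-sym (r~ (ny t))) (tri-outer (tri-rot t) ∘ M-sym) m)
      go _ (inj₂ (inj₂ m)) = ⊥-elim (not-mid-outer (~-sym (r~ (nz t))) (tri-outer (tri-rot (tri-rot t)) ∘ M-sym) m)
      go (inj₂ e@(inj₁ (_ , _ , _ , _ , _ , D))) _
        with end-outer-only D (~-sym (r~ (ny t))) (tri-outer (tri-rot t) ∘ M-sym)
      ... | refl = dia e (add-branch-dia σ t D u∈ x′∈ p∉ q∉ y′∉)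
                     (grow< (branch-dia-unique t D) (p∉ ∷ q∉ ∷ dia-outside σ D y′∉))
      go _ (inj₂ e@(inj₁ (_ , _ , _ , _ , _ , D)))
        with end-outer-only D (~-sym (r~ (nz t))) (tri-outer (tri-rot (tri-rot t)) ∘ M-sym)
      ... | refl = dia e (add-branch-dia σ (tri-swp t) D u∈ x′∈ q∉ p∉ z′∉)
                     (grow< (branch-dia-unique (tri-swp t) D) (q∉ ∷ p∉ ∷ dia-outside σ D z′∉))

    step-outer : u ∈ E → v ∉ E → u ~ v → ¬ M u v → Step φ E
    step-outer {v = v} u∈ v∉ e ¬m with kind v
    ... | inj₁ t = gain (gain-tri σ u∈ v∉ e ¬m t) (grow< ([] ∷ []) (v∉ ∷ []))
    ... | inj₂ d@(inj₁ (_ , _ , _ , _ , _ , D)) =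
      dia d (add-dia σ u∈ e ¬m D v∉) (grow< (dia-unique D) (dia-outside σ D v∉))
    ... | inj₂ (inj₂ m) = ⊥-elim (not-mid-outer (~-sym e) (¬m ∘ M-sym) m)

    -- If `u` is `Full`, the edge `u v` leaves its unit. Otherwise `u` is an entered triangle vertex
    -- with its outer neighbour in `E`, so `v` is in its triangle.
    advance : u ∈ E → v ∉ E → u ~ v → Step φ E
    advance {u} u∈ v∉ e with State.settled σ u∈ | kind u
    ... | inj₁ f | _ = step-outer u∈ v∉ e (v∉ ∘ f)
    ... | inj₂ (¬D , _) | inj₂ D = contradiction D ¬D
    ... | inj₂ (_ , f) | inj₁ (_ , _ , _ , _ , _ , t) with only (nx t) e | f (r~ (nx t)) (tri-outer t)
    ...   | inj₁ refl | x′∈        = step-branch t u∈ x′∈ v∉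
    ...   | inj₂ (inj₁ refl) | x′∈ = step-branch (tri-swp t) u∈ x′∈ v∉
    ...   | inj₂ (inj₂ refl) | x′∈ = contradiction x′∈ v∉

  -- Running the process to the end

  boundary : u ∈ E → v ∉ E → ∃[ x ] ∃[ y ] (x ∈ E × y ∉ E × x ~ y)
  boundary {u} {E} {v} u∈ v∉ = go (proj₂ connected u v) v∉
    where
    go : Reach G u w → w ∉ E → ∃[ x ] ∃[ y ] (x ∈ E × y ∉ E × x ~ y)
    go here w∉ = contradiction u∈ w∉
    go (step {v = x} r e) w∉ with x ∈? E
    ... | yes x∈ = _ , _ , x∈ , w∉ , e
    ... | no x∉  = go r x∉

  covers? : (E : VSet n) → (∀ v → v ∈ E) ⊎ ∃[ v ] v ∉ E
  covers? E with any? (λ v → ¬? (v ∈? E))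
  ... | yes h = inj₂ h
  ... | no h  = inj₁ λ v → decidable-stable (v ∈? E) (λ v∉ → h (v , v∉))

  -- The argument is a surplus, not a size: `TFS≤ 0` gives at most `n/2` vertices, `TFS≤ 1` strictly
  -- fewer.
  TFS≤ : ℕ → Set
  TFS≤ φ = ∃[ S ] (TotalForcingSet G S × 2 * count S + φ ≤ n)

  finish : ∀ {φ} → State φ E → (∀ v → v ∈ E) → TFS≤ φ
  finish {E} σ all = State.S σ , ((λ v → State.colored σ (all v)) , State.total σ) ,
    ≤-trans (State.bound σ) (count≤ E)

  weaken : ∀ {φ} → State (suc φ) E → State φ E
  weaken σ = record { State σ ; bound = ≤-trans (+-monoʳ-≤ _ (n≤1+n _)) (State.bound σ) }

  shrink : ∀ {i k f} → i < k → n ≤ i + suc f → n ≤ k + f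
  shrink {i} {k} {f} i<k h = ≤-trans h (≤-trans (≤-reflexive (+-suc i f)) (+-monoˡ-≤ f i<k))

  nonempty : ∀ {i} → i < count F → ∃[ v ] v ∈ F
  nonempty {F} lt = count-witness F (≤-trans (s≤s z≤n) lt)

  -- Every move enlarges `E`, so the fuel bounds the vertices still outside. Further gains are
  -- dropped: `φ` already records the surplus that is wanted.
  complete : ∀ {φ} fuel → n ≤ count E + fuel → State φ E → u ∈ E → TFS≤ φ
  complete {E} fuel h σ u∈ with covers? E
  ... | inj₁ all = finish σ all
  complete {E} zero h σ u∈ | inj₂ (v , v∉) =
    contradiction (≤-trans h (≤-reflexive (+-identityʳ _))) (<⇒≱ (count<n E v∉))
  complete {E} (suc fuel) h σ u∈ | inj₂ (v , v∉) with boundary u∈ v∉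
  ... | x , y , x∈ , y∉ , e with advance σ x∈ y∉ e
  ...   | gain σ′ lt  = complete fuel (shrink lt h) (weaken σ′) (proj₂ (nonempty lt))
  ...   | dia _ σ′ lt = complete fuel (shrink lt h) σ′ (proj₂ (nonempty lt))
  ...   | branch t u∈′ fresh ty tz =
          complete fuel (shrink (grow< (branch-unique t) fresh) h) (add-branch σ t u∈′ fresh ty tz) (∈⊕ʳ _ u∈)

  complete′ : ∀ {φ} → State φ E → u ∈ E → TFS≤ φ
  complete′ σ = complete n (m≤n+m n _) σ

  -- A start is a move from the empty state, so it obeys the same accounting.
  initial : ∀ xs ys → Unique xs → All (Supported (∅ ⊕ ys)) ys → All (Colored G (∅ ⊕ ys)) xs →
            All (Settled (∅ ⊕ xs)) xs → ∀ g → 2 * length ys + g ≤ length xs → State (g + 0) (∅ ⊕ xs)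
  initial xs ys uniq = extend empty xs ys uniq (All.tabulate λ _ ())
    where
    empty : State 0 ∅
    empty = record { S = ∅ ; total = λ _ () ; colored = λ () ; settled = λ ()
                   ; bound = ≤-trans (≤-reflexive (cong (λ k → 2 * k + 0) (count-∅ n))) z≤n }

  pattern here₀ = hereˡ refl
  pattern here₁ = thereˡ here₀
  pattern here₂ = thereˡ here₁
  pattern here₃ = thereˡ here₂
  pattern here₄ = thereˡ here₃
  pattern here₅ = thereˡ here₄

  source : ∀ {ys} → v ∈ˡ ys → Colored G (∅ ⊕ ys) v
  source i = init (∈⊕ˡ i)

  -- Graphs with a diamond

  -- Both ends of the diamond lead to one triangle. From `x`, `a`, `c` the vertices `d`, `b`, `y`,
  -- `w` are forced in turn: three for seven.
  loop : Tri x y w x′ y′ z′ → Dia a b c d x y → TFS≤ 1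
  loop {x} {y} {w} {a = a} {b} {c} {d} t D
    with tri-outer-only t (~-sym (r~ (na D))) (end-outer D ∘ M-sym)
       | tri-outer-only (tri-rot t) (~-sym (r~ (nb D))) (end-outer (dia-flip D) ∘ M-sym)
  ... | refl | refl = complete′ σ (∈⊕ˡ here₀)
    where
    xs = x ∷ y ∷ w ∷ a ∷ b ∷ c ∷ d ∷ []
    ys = x ∷ a ∷ c ∷ []
    cx = source {ys = ys} here₀
    ca = source {ys = ys} here₁
    cc = source {ys = ys} here₂
    cd = forceN (swp (na D)) ca cc cx
    cb = forceN (swp (nc D)) cc ca cd
    cy = forceN (nb D) cb cc cd
    cw = forceN (swp (nx t)) cx cy ca
    σ : State 1 (∅ ⊕ xs)
    σ = initial xs ys
      ((~⇒≢ (p~ (nx t)) ∷ ~⇒≢ (q~ (nx t)) ∷ All.map (tri≢dia (tri₁ t)) (dia-vertices D)) ∷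
       (~⇒≢ (p~ (ny t)) ∷ All.map (tri≢dia (tri₂ t)) (dia-vertices D)) ∷
       All.map (tri≢dia (tri₃ t)) (dia-vertices D) ∷ dia-unique D)
      ((a , ∈⊕ˡ here₁ , r~ (nx t)) ∷ (x , ∈⊕ˡ here₀ , r~ (na D)) ∷ (a , ∈⊕ˡ here₁ , p~ (nc D)) ∷ [])
      (cx ∷ cy ∷ cw ∷ ca ∷ cb ∷ cc ∷ cd ∷ [])
      (settled-tri t (∈⊕ˡ here₁) (∈⊕ˡ here₂) ∷ settled-tri (tri-rot t) (∈⊕ˡ here₂) (∈⊕ˡ here₀) ∷
       settled-tri (tri-rot (tri-rot t)) (∈⊕ˡ here₀) (∈⊕ˡ here₁) ∷
       settled-dia D (All.tabulate λ i → ∈⊕ˡ (thereˡ (thereˡ (thereˡ i)))))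
      1 ≤-refl

  dia-closed : Dia a b c d a′ b′ → v ∈ˡ (a ∷ b ∷ c ∷ d ∷ []) → M v w → w ∈ˡ (a ∷ b ∷ c ∷ d ∷ [])
  dia-closed D here₀ m = [ (λ { refl → here₂ }) , (λ { refl → here₃ }) ]′ (end-M D m)
  dia-closed D here₁ m = [ (λ { refl → here₂ }) , (λ { refl → here₃ }) ]′ (end-M (dia-flip D) m)
  dia-closed D here₂ (e , _) =
    [ (λ { refl → here₀ }) , [ (λ { refl → here₁ }) , (λ { refl → here₃ }) ]′ ]′ (only (nc D) e)
  dia-closed D here₃ (e , _) =
    [ (λ { refl → here₀ }) , [ (λ { refl → here₁ }) , (λ { refl → here₂ }) ]′ ]′ (only (nd D) e)

  -- Edges in triangles never leave a diamond, so a walk along them from `v` to `e` inside the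
  -- second diamond stays in the first.
  dia-meet : Dia a b c d a′ b′ → Dia e f g x x′ y′ →
             v ∈ˡ (a ∷ b ∷ c ∷ d ∷ []) → v ∈ˡ (e ∷ f ∷ g ∷ x ∷ []) → e ∈ˡ (a ∷ b ∷ c ∷ d ∷ [])
  dia-meet D D₂ i here₀ = i
  dia-meet D D₂ i here₁ =
    dia-closed D (dia-closed D i (dia-M-ac (dia-flip D₂))) (M-sym (dia-M-ac D₂))
  dia-meet D D₂ i here₂ = dia-closed D i (M-sym (dia-M-ac D₂))
  dia-meet D D₂ i here₃ = dia-closed D i (M-sym (dia-M-ac (dia-swp D₂)))

  outer∉dia : Dia a b c d a′ b′ → ¬ a′ ∈ˡ (a ∷ b ∷ c ∷ d ∷ [])
  outer∉dia D here₀ = ~⇒≢ (r~ (na D)) refl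
  outer∉dia D here₁ = a′≢b D refl
  outer∉dia D here₂ = p≢r (na D) refl
  outer∉dia D here₃ = q≢r (na D) refl

  AllDiamonds : Set
  AllDiamonds = (∀ v → InDia v) × TFS≤ 0

  -- While `E` is made of diamonds, every edge leaving it is outer. Either some such edge reaches a
  -- triangle vertex, which gains, or diamonds exhaust the graph.
  grow : ∀ fuel → n ≤ count E + fuel → State 0 E → (∀ {v} → v ∈ E → InDia v) → u ∈ E → TFS≤ 1 ⊎ AllDiamonds
  grow {E} fuel h σ ds u∈ with covers? E
  ... | inj₁ all = inj₂ ((λ v → ds (all v)) , finish σ all)
  grow {E} zero h σ ds u∈ | inj₂ (v , v∉) =
    contradiction (≤-trans h (≤-reflexive (+-identityʳ _))) (<⇒≱ (count<n E v∉))
  grow {E} (suc fuel) h σ ds u∈ | inj₂ (v , v∉) with boundary u∈ v∉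
  ... | x , y , x∈ , y∉ , e = go (kind y)
    where
    ¬m : ¬ M x y
    ¬m m = y∉ (full-dia σ (ds x∈) x∈ m)
    go : IsTri y ⊎ InDia y → TFS≤ 1 ⊎ AllDiamonds
    go (inj₁ t) = inj₁ (complete′ (gain-tri σ x∈ y∉ e ¬m t) (∈⊕ʳ (y ∷ []) x∈))
    go (inj₂ (inj₂ m)) = ⊥-elim (not-mid-outer (~-sym e) (¬m ∘ M-sym) m)
    go (inj₂ (inj₁ (_ , _ , _ , _ , _ , D))) =
      grow fuel (shrink (grow< (dia-unique D) (dia-outside σ D y∉)) h) (add-dia σ x∈ e ¬m D y∉)
        (λ v∈ → [ All.lookup (dia-vertices D) , ds ]′ (∈⊕⁻ E _ v∈)) (∈⊕ʳ _ x∈)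

  -- The adjacent ends `a` and `e` are each other's outer neighbours, so with one middle vertex each
  -- they force the remaining ones, which yields the far ends: four for eight.
  pair : Dia a b c d e b′ → IsEnd e → TFS≤ 1 ⊎ AllDiamonds
  pair {a} {b} {c} {d} {e} D (f , g , h , _ , _ , D₂)
    with end-outer-only D₂ (~-sym (r~ (na D))) (end-outer D ∘ M-sym)
  ... | refl = grow n (m≤n+m n _) σ
      (λ v∈ → [ All.lookup (Allₚ.++⁺ (dia-vertices D) (dia-vertices D₂)) , (λ ()) ]′ (∈⊕⁻ ∅ xs v∈))
      (∈⊕ˡ here₀)
    where
    xs = a ∷ b ∷ c ∷ d ∷ e ∷ f ∷ g ∷ h ∷ []
    ys = a ∷ c ∷ e ∷ g ∷ []
    ca = source {ys = ys} here₀
    cc = source {ys = ys} here₁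
    ce = source {ys = ys} here₂
    cg = source {ys = ys} here₃
    cd = forceN (swp (na D)) ca cc ce
    cb = forceN (swp (nc D)) cc ca cd
    ch = forceN (swp (na D₂)) ce cg ca
    cf = forceN (swp (nc D₂)) cg ce ch
    σ : State 0 (∅ ⊕ xs)
    σ = initial xs ys
      (Uniqueₚ.++⁺ (dia-unique D) (dia-unique D₂) (λ (i , j) → outer∉dia D (dia-meet D D₂ i j)))
      ((c , ∈⊕ˡ here₁ , p~ (na D)) ∷ (a , ∈⊕ˡ here₀ , p~ (nc D)) ∷
       (g , ∈⊕ˡ here₃ , p~ (na D₂)) ∷ (e , ∈⊕ˡ here₂ , p~ (nc D₂)) ∷ [])
      (ca ∷ cb ∷ cc ∷ cd ∷ ce ∷ cf ∷ cg ∷ ch ∷ [])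
      (Allₚ.++⁺ (settled-dia D (All.tabulate λ i → ∈⊕ˡ (∈-++⁺ˡ i)))
                (settled-dia D₂ (All.tabulate λ i → ∈⊕ˡ (∈-++⁺ʳ (a ∷ b ∷ c ∷ d ∷ []) i))))
      0 ≤-refl

  -- The triangle, the diamond and `p` are a start of four for eight without surplus. It is
  -- continued across the outer edge of `y`: a triangle vertex there gains; a second diamond leads
  -- on to `q`, which is a new triangle vertex and gains, or equals `w` and gives `loop`, or is a
  -- diamond end and gives `pair`.
  bridge : Tri x y w a y′ z′ → Dia a b c d x p → IsTri p → p ≢ y → p ≢ w → TFS≤ 1 ⊎ AllDiamonds
  bridge {x} {y} {w} {a} {y′} {z′} {b} {c} {d} {p} t D tp p≢y p≢w = go (kind y′)
    where
    xs = x ∷ y ∷ w ∷ p ∷ a ∷ b ∷ c ∷ d ∷ []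
    ys = x ∷ y ∷ a ∷ c ∷ []
    cx = source {ys = ys} here₀
    cy = source {ys = ys} here₁
    ca = source {ys = ys} here₂
    cc = source {ys = ys} here₃
    cd = forceN (swp (na D)) ca cc cx
    cb = forceN (swp (nc D)) cc ca cd
    cp = forceN (nb D) cb cc cd
    cw = forceN (swp (nx t)) cx cy ca
    x~a = r~ (nx t)
    ¬Mxa = tri-outer t
    p~b = ~-sym (r~ (nb D))
    ¬Mpb : ¬ M p b
    ¬Mpb = end-outer (dia-flip D) ∘ M-sym
    y~y′ = r~ (ny t)
    ¬Myy′ = tri-outer (tri-rot t)
    p≢x : p ≢ x
    p≢x refl = p≢q (nc D) (outer-unique x~a ¬Mxa p~b ¬Mpb)
    D-vs = dia-vertices D
    E₁ = ∅ ⊕ xs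
    σ : State 0 E₁
    σ = initial xs ys
      ((~⇒≢ (p~ (nx t)) ∷ ~⇒≢ (q~ (nx t)) ∷ (p≢x ∘ sym) ∷ All.map (tri≢dia (tri₁ t)) D-vs) ∷
       (~⇒≢ (p~ (ny t)) ∷ (p≢y ∘ sym) ∷ All.map (tri≢dia (tri₂ t)) D-vs) ∷
       ((p≢w ∘ sym) ∷ All.map (tri≢dia (tri₃ t)) D-vs) ∷
       All.map (tri≢dia tp) D-vs ∷ dia-unique D)
      ((y , ∈⊕ˡ here₁ , p~ (nx t)) ∷ (x , ∈⊕ˡ here₀ , q~ (ny t)) ∷
       (x , ∈⊕ˡ here₀ , r~ (na D)) ∷ (a , ∈⊕ˡ here₂ , p~ (nc D)) ∷ [])
      (cx ∷ cy ∷ cw ∷ cp ∷ ca ∷ cb ∷ cc ∷ cd ∷ [])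
      (settled-tri t (∈⊕ˡ here₁) (∈⊕ˡ here₂) ∷ settled-tri (tri-rot t) (∈⊕ˡ here₂) (∈⊕ˡ here₀) ∷
       settled-tri (tri-rot (tri-rot t)) (∈⊕ˡ here₀) (∈⊕ˡ here₁) ∷
       settled-entered tp p~b ¬Mpb (∈⊕ˡ here₅) ∷
       settled-dia D (All.tabulate λ i → ∈⊕ˡ (thereˡ (thereˡ (thereˡ (thereˡ i))))))
      0 ≤-refl
    y∈ : y ∈ E₁
    y∈ = ∈⊕ˡ here₁
    y′∉xs : ¬ y′ ∈ˡ xs
    y′∉xs here₀ = q≢r (ny t) refl
    y′∉xs here₁ = ~⇒≢ y~y′ refl
    y′∉xs here₂ = p≢r (ny t) refl
    y′∉xs here₃ = tri≢dia (tri₂ t) (inj₁ (_ , _ , _ , _ , _ , dia-flip D))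
      (outer-unique (~-sym y~y′) (¬Myy′ ∘ M-sym) p~b ¬Mpb)
    y′∉xs here₄ = ~⇒≢ (q~ (ny t)) (end-outer-only D (~-sym y~y′) (¬Myy′ ∘ M-sym))
    y′∉xs here₅ = p≢y (sym (end-outer-only (dia-flip D) (~-sym y~y′) (¬Myy′ ∘ M-sym)))
    y′∉xs (thereˡ here₅) = not-mid-outer (~-sym y~y′) (¬Myy′ ∘ M-sym) (_ , _ , _ , _ , _ , D)
    y′∉xs (thereˡ (thereˡ here₅)) = not-mid-outer (~-sym y~y′) (¬Myy′ ∘ M-sym) (_ , _ , _ , _ , _ , dia-swp D)
    y′∉ : y′ ∉ E₁
    y′∉ h = [ y′∉xs , (λ ()) ]′ (∈⊕⁻ ∅ xs h)

    second : ∀ {b₂ c₂ d₂ q} → Dia y′ b₂ c₂ d₂ y q → IsTri q ⊎ InDia q → TFS≤ 1 ⊎ AllDiamonds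
    second {b₂} {c₂} {d₂} {q} D₂ k = go₂ k
      where
      σ₂ = add-dia σ y∈ y~y′ ¬Myy′ D₂ y′∉
      q~b₂ = ~-sym (r~ (nb D₂))
      ¬Mqb₂ : ¬ M q b₂
      ¬Mqb₂ = end-outer (dia-flip D₂) ∘ M-sym
      b₂∉ : b₂ ∉ E₁
      b₂∉ with dia-outside σ D₂ y′∉
      ... | _ ∷ h ∷ _ = h
      -- The outer edges of `x`, `y` and `p` go to `a`, `y′` and `b`, none of which is `b₂`; among
      -- the triangle vertices of `E₁` this leaves `w`.
      meets : IsTri q → q ∈ˡ xs → TFS≤ 1
      meets tq here₀ = ⊥-elim (b₂∉ (subst (_∈ E₁) (outer-unique x~a ¬Mxa q~b₂ ¬Mqb₂) (∈⊕ˡ here₄)))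
      meets tq here₁ = ⊥-elim (p≢q (nc D₂) (outer-unique y~y′ ¬Myy′ q~b₂ ¬Mqb₂))
      meets tq here₂ = loop (tri-rot t) D₂
      meets tq here₃ = ⊥-elim (b₂∉ (subst (_∈ E₁) (outer-unique p~b ¬Mpb q~b₂ ¬Mqb₂) (∈⊕ˡ here₅)))
      meets tq (thereˡ (thereˡ (thereˡ (thereˡ i)))) = ⊥-elim (tri-not-dia tq (All.lookup D-vs i))
      go₂ : IsTri q ⊎ InDia q → TFS≤ 1 ⊎ AllDiamonds
      go₂ (inj₂ (inj₂ m)) = ⊥-elim (not-mid-outer q~b₂ ¬Mqb₂ m)
      go₂ (inj₂ (inj₁ e)) = pair (dia-flip D₂) e
      go₂ (inj₁ tq) with q ∈? (E₁ ⊕ (y′ ∷ b₂ ∷ c₂ ∷ d₂ ∷ []))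
      ... | no q∉ = inj₁ (complete′ (gain-tri σ₂ {u = b₂} (∈⊕ˡ here₁) q∉ (~-sym q~b₂) (¬Mqb₂ ∘ M-sym) tq)
                            (∈⊕ʳ (q ∷ []) (∈⊕ˡ here₁)))
      ... | yes q∈ with ∈⊕⁻ E₁ (y′ ∷ b₂ ∷ c₂ ∷ d₂ ∷ []) q∈
      ...   | inj₁ i = ⊥-elim (tri-not-dia tq (All.lookup (dia-vertices D₂) i))
      ...   | inj₂ q∈E₁ = inj₁ ([ meets tq , (λ ()) ]′ (∈⊕⁻ ∅ xs q∈E₁))

    go : IsTri y′ ⊎ InDia y′ → TFS≤ 1 ⊎ AllDiamonds
    go (inj₁ ty′) = inj₁ (complete′ (gain-tri σ y∈ y′∉ y~y′ ¬Myy′ ty′) (∈⊕ʳ (y′ ∷ []) y∈))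
    go (inj₂ (inj₂ m)) = ⊥-elim (not-mid-outer (~-sym y~y′) (¬Myy′ ∘ M-sym) m)
    go (inj₂ (inj₁ (_ , _ , _ , _ , q , D₂))) with end-outer-only D₂ (~-sym y~y′) (¬Myy′ ∘ M-sym)
    ... | refl = second D₂ (kind q)

  with-diamond : Dia a b c d a′ b′ → TFS≤ 1 ⊎ AllDiamonds
  with-diamond {a} {b} {c} {d} {x} {p} D = go (kind x) (kind p)
    where
    x~a = ~-sym (r~ (na D))
    ¬Mxa : ¬ M x a
    ¬Mxa = end-outer D ∘ M-sym
    go : IsTri x ⊎ InDia x → IsTri p ⊎ InDia p → TFS≤ 1 ⊎ AllDiamonds
    go (inj₂ (inj₁ e)) _ = pair D e
    go (inj₂ (inj₂ m)) _ = ⊥-elim (not-mid-outer x~a ¬Mxa m)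
    go _ (inj₂ (inj₁ e)) = pair (dia-flip D) e
    go _ (inj₂ (inj₂ m)) = ⊥-elim (not-mid-outer (~-sym (r~ (nb D))) (end-outer (dia-flip D) ∘ M-sym) m)
    go (inj₁ (y , w , _ , _ , _ , t)) (inj₁ tp) with p ≟ y | p ≟ w | tri-outer-only t x~a ¬Mxa
    ... | yes refl | _ | _ = inj₁ (loop t D)
    ... | no _ | yes refl | _ = inj₁ (loop (tri-swp t) D)
    ... | no p≢y | no p≢w | refl = bridge t D tp p≢y p≢w

  -- Graphs without a diamond

  PrismCase : Set
  PrismCase = Iso G Prism × TFS≤ 0

  prism-iso : Tri u p q r x′ y′ → Tri x′ y′ r p q u → Iso G Prism
  prism-iso {u} {p} {q} {r} {x′} {y′} t s = mkIso pt (lookup-injective distinct) zero nbr edge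
    where
    vs : List (Fin n)
    vs = u ∷ p ∷ q ∷ r ∷ x′ ∷ y′ ∷ []
    distinct : Unique vs
    distinct =
      (~⇒≢ (p~ (nx t)) ∷ ~⇒≢ (q~ (nx t)) ∷ ~⇒≢ (r~ (nx t)) ∷ q≢r (ny t) ∷ p≢r (nz t) ∷ []) ∷
      (~⇒≢ (p~ (ny t)) ∷ p≢r (nx t) ∷ ~⇒≢ (r~ (ny t)) ∷ q≢r (nz t) ∷ []) ∷
      (q≢r (nx t) ∷ p≢r (ny t) ∷ ~⇒≢ (r~ (nz t)) ∷ []) ∷
      (~⇒≢ (p~ (nz s)) ∷ ~⇒≢ (q~ (nz s)) ∷ []) ∷ (~⇒≢ (p~ (nx s)) ∷ []) ∷ [] ∷ []
    pt : Fin 6 → Fin n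
    pt = lookup vs
    nbs : Fin 6 → Fin 6 × Fin 6 × Fin 6
    nbs zero = # 1 , # 2 , # 3
    nbs (suc zero) = # 2 , # 0 , # 4
    nbs (suc (suc zero)) = # 0 , # 1 , # 5
    nbs (suc (suc (suc zero))) = # 4 , # 5 , # 0
    nbs (suc (suc (suc (suc zero)))) = # 5 , # 3 , # 1
    nbs (suc (suc (suc (suc (suc zero))))) = # 3 , # 4 , # 2
    N : ∀ i → Nbrs (pt i) (pt (proj₁ (nbs i))) (pt (proj₁ (proj₂ (nbs i)))) (pt (proj₂ (proj₂ (nbs i))))
    N zero = nx t
    N (suc zero) = ny t
    N (suc (suc zero)) = nz t
    N (suc (suc (suc zero))) = nz s
    N (suc (suc (suc (suc zero)))) = nx s
    N (suc (suc (suc (suc (suc zero))))) = ny s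
    Adj : Fin 6 → Fin 6 → Set
    Adj i j = j ≡ proj₁ (nbs i) ⊎ j ≡ proj₁ (proj₂ (nbs i)) ⊎ j ≡ proj₂ (proj₂ (nbs i))
    -- The neighbour table `nbs` is compared with `Prism` on all 36 pairs by evaluation.
    Adj⇒Prism : ∀ i j → Adj i j → T (Prism i j)
    Adj⇒Prism = toWitness {a? = all? λ i → all? λ j →
      (j ≟ proj₁ (nbs i) ⊎-dec (j ≟ proj₁ (proj₂ (nbs i)) ⊎-dec j ≟ proj₂ (proj₂ (nbs i)))) →-dec T? (Prism i j)} tt
    Prism⇒Adj : ∀ i j → T (Prism i j) → Adj i j
    Prism⇒Adj = toWitness {a? = all? λ i → all? λ j →
      T? (Prism i j) →-dec (j ≟ proj₁ (nbs i) ⊎-dec (j ≟ proj₁ (proj₂ (nbs i)) ⊎-dec j ≟ proj₂ (proj₂ (nbs i))))} tt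
    nbr : ∀ i {w} → pt i ~ w → ∃[ j ] (pt j ≡ w × T (Prism i j))
    nbr i e with only (N i) e
    ... | inj₁ eq = _ , sym eq , Adj⇒Prism i _ (inj₁ refl)
    ... | inj₂ (inj₁ eq) = _ , sym eq , Adj⇒Prism i _ (inj₂ (inj₁ refl))
    ... | inj₂ (inj₂ eq) = _ , sym eq , Adj⇒Prism i _ (inj₂ (inj₂ refl))
    edge : ∀ i j → T (Prism i j) → pt i ~ pt j
    edge i j h with Prism⇒Adj i j h
    ... | inj₁ refl = p~ (N i)
    ... | inj₂ (inj₁ refl) = q~ (N i)
    ... | inj₂ (inj₂ refl) = r~ (N i)

  module _ (tri : ∀ v → IsTri v) where

    -- From `p`, `q`, `y′` the vertices `u`, `z′`, `r` are forced: three for six. The outer edge of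
    -- `u` either ends at `r`, which closes the prism, or reaches a new triangle vertex and gains.
    twin-triangles : Tri u p q x′ y′ z′ → Tri y′ z′ r p q w → TFS≤ 1 ⊎ PrismCase
    twin-triangles {u} {p} {q} {x′} {y′} {z′} {r} t s = go (x′ ≟ r)
      where
      xs = u ∷ p ∷ q ∷ y′ ∷ z′ ∷ r ∷ []
      ys = p ∷ q ∷ y′ ∷ []
      r≢u : r ≢ u
      r≢u refl = [ ~⇒≢ (r~ (ny t)) ∘ sym , p≢r (ny t) ∘ sym ]′ (tri-M t (M-sym (tri-M-z s)))
      p≢r′ : p ≢ r
      p≢r′ refl = tri-outer s (tri-M-z s)
      q≢r′ : q ≢ r
      q≢r′ refl = tri-outer (tri-rot s) (tri-M-y (tri-rot s))
      cp = source {ys = ys} here₀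
      cq = source {ys = ys} here₁
      cy = source {ys = ys} here₂
      cu = forceN (swp (ny t)) cp cq cy
      cz = forceN (nz t) cq cu cp
      cr = forceN (swp (nx s)) cy cz cp
      E₁ = ∅ ⊕ xs
      σ : State 0 E₁
      σ = initial xs ys
        ((~⇒≢ (p~ (nx t)) ∷ ~⇒≢ (q~ (nx t)) ∷ q≢r (ny t) ∷ p≢r (nz t) ∷ (r≢u ∘ sym) ∷ []) ∷
         (~⇒≢ (p~ (ny t)) ∷ ~⇒≢ (r~ (ny t)) ∷ q≢r (nz t) ∷ p≢r′ ∷ []) ∷
         (p≢r (ny t) ∷ ~⇒≢ (r~ (nz t)) ∷ q≢r′ ∷ []) ∷
         (~⇒≢ (p~ (nx s)) ∷ ~⇒≢ (q~ (nx s)) ∷ []) ∷ (~⇒≢ (p~ (ny s)) ∷ []) ∷ [] ∷ [])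
        ((q , ∈⊕ˡ here₁ , p~ (ny t)) ∷ (p , ∈⊕ˡ here₀ , q~ (nz t)) ∷ (p , ∈⊕ˡ here₀ , r~ (nx s)) ∷ [])
        (cu ∷ cp ∷ cq ∷ cy ∷ cz ∷ cr ∷ [])
        (settled-tri t (∈⊕ˡ here₁) (∈⊕ˡ here₂) ∷ settled-tri (tri-rot t) (∈⊕ˡ here₂) (∈⊕ˡ here₀) ∷
         settled-tri (tri-rot (tri-rot t)) (∈⊕ˡ here₀) (∈⊕ˡ here₁) ∷
         settled-tri s (∈⊕ˡ here₄) (∈⊕ˡ here₅) ∷ settled-tri (tri-rot s) (∈⊕ˡ here₅) (∈⊕ˡ here₃) ∷
         settled-tri (tri-rot (tri-rot s)) (∈⊕ˡ here₃) (∈⊕ˡ here₄) ∷ [])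
        0 ≤-refl
      u∈ : u ∈ E₁
      u∈ = ∈⊕ˡ here₀
      x′~u = ~-sym (r~ (nx t))
      ¬Mx′u : ¬ M x′ u
      ¬Mx′u = tri-outer t ∘ M-sym
      x′∉xs : x′ ≢ r → ¬ x′ ∈ˡ xs
      x′∉xs _ here₀ = ~⇒≢ x′~u refl
      x′∉xs _ here₁ = p≢r (nx t) refl
      x′∉xs _ here₂ = q≢r (nx t) refl
      x′∉xs _ here₃ = x′≢y′ t refl
      x′∉xs _ here₄ = z′≢x′ t refl
      x′∉xs x′≢r here₅ = x′≢r refl
      go : Dec (x′ ≡ r) → TFS≤ 1 ⊎ PrismCase
      go (yes refl) with tri-outer-only (tri-rot (tri-rot s)) x′~u ¬Mx′u
      ... | refl = inj₂ (prism-iso t s , complete′ σ u∈)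
      go (no x′≢r) = inj₁ (complete′
        (gain-tri σ u∈ (λ h → [ x′∉xs x′≢r , (λ ()) ]′ (∈⊕⁻ ∅ xs h)) (~-sym x′~u) (¬Mx′u ∘ M-sym) (tri x′))
        (∈⊕ʳ (x′ ∷ []) u∈))

    -- The outer neighbour of `y′` is `p`, so `z′` lies in the triangle of `y′`, and two edges join
    -- that triangle to `u p q`.
    double-edge : Tri u p q x′ y′ z′ → y′ ~ z′ → TFS≤ 1 ⊎ PrismCase
    double-edge {y′ = y′} {z′} t e with tri y′
    ... | _ , _ , _ , _ , _ , s
      with tri-outer-only s (~-sym (r~ (ny t))) (tri-outer (tri-rot t) ∘ M-sym) | only (nx s) e
    ... | refl | inj₂ (inj₂ refl) = contradiction refl (q≢r (nz t))
    ... | refl | inj₁ refl with tri-outer-only (tri-rot s) (~-sym (r~ (nz t))) (tri-outer (tri-rot (tri-rot t)) ∘ M-sym)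
    ...   | refl = twin-triangles t s
    double-edge {y′ = y′} {z′} t e | _ , _ , _ , _ , _ , s | refl | inj₂ (inj₁ refl)
      with tri-outer-only (tri-rot (tri-swp s)) (~-sym (r~ (nz t))) (tri-outer (tri-rot (tri-rot t)) ∘ M-sym)
    ... | refl = twin-triangles t (tri-swp s)

    -- The invariant is that some vertex is outside `E`. If both triangle mates of `y′` are in `E`,
    -- then `y′` is a gain and replaces the branch. Otherwise a mate outside `E` stays outside after
    -- the branch, since `z′` is not a mate unless `double-edge` applies. So branches alone never
    -- cover the graph.
    branching : ∀ fuel → n ≤ count E + fuel → State 0 E → u ∈ E → v ∉ E → TFS≤ 1 ⊎ PrismCase
    branching {E} zero h σ u∈ v∉ =
      contradiction (≤-trans h (≤-reflexive (+-identityʳ _))) (<⇒≱ (count<n E v∉))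
    branching {E} (suc fuel) h σ u∈ v∉ with boundary u∈ v∉
    ... | _ , _ , x∈ , y∉ , e with advance σ x∈ y∉ e
    ...   | gain σ′ lt = inj₁ (complete′ σ′ (proj₂ (nonempty lt)))
    ...   | dia {v = v} d _ _ = contradiction d (tri-not-dia (tri v))
    ...   | branch {u} {p} {q} {_} {y′} {z′} t u∈′ fresh _ _ with T? (G y′ z′)
    ...     | yes e′ = double-edge t e′
    ...     | no y′≁z′ = go (tri y′)
      where
      xs = p ∷ q ∷ y′ ∷ z′ ∷ []
      σ′ = add-branch σ t u∈′ fresh (tri y′) (tri z′)
      h′ = shrink (grow< (branch-unique t) fresh) h
      y′∉ : y′ ∉ E
      y′∉ = All.lookup fresh here₂
      mate-fresh : M y′ w → w ∉ E → w ∉ E ⊕ xs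
      mate-fresh m w∉ h with ∈⊕⁻ E xs h
      ... | inj₂ w∈ = w∉ w∈
      ... | inj₁ here₀ = tri-outer (tri-rot t) (M-sym m)
      ... | inj₁ here₁ = [ q≢r (ny t) ∘ sym , ~⇒≢ (r~ (ny t)) ∘ sym ]′ (tri-M (tri-rot (tri-rot t)) (M-sym m))
      ... | inj₁ here₂ = ~⇒≢ (proj₁ m) refl
      ... | inj₁ here₃ = y′≁z′ (proj₁ m)
      go : IsTri y′ → TFS≤ 1 ⊎ PrismCase
      go (a , b , _ , _ , _ , s) with a ∈? E | b ∈? E
      ... | yes a∈ | yes b∈ = inj₁ (complete′ (gain-third σ (tri-swp (tri-rot s)) a∈ b∈ y′∉) (∈⊕ʳ (y′ ∷ []) a∈))
      ... | no a∉ | _ = branching fuel h′ σ′ (∈⊕ʳ xs u∈) (mate-fresh (tri-M-y s) a∉)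
      ... | _ | no b∉ = branching fuel h′ σ′ (∈⊕ʳ xs u∈) (mate-fresh (tri-M-z s) b∉)

    -- A whole triangle forces its outer neighbours: three for six. If no two of these are adjacent,
    -- the mates of `x′` are still outside, as `branching` requires.
    without-diamond : Fin n → TFS≤ 1 ⊎ PrismCase
    without-diamond x with tri x
    ... | y , w , x′ , y′ , w′ , t with T? (G y′ w′) | T? (G w′ x′) | T? (G x′ y′)
    ... | yes e | _ | _ = double-edge t e
    ... | _ | yes e | _ = double-edge (tri-rot t) e
    ... | _ | _ | yes e = double-edge (tri-rot (tri-rot t)) e
    ... | no y≁w | no w≁x | no x≁y = go (tri x′)
      where
      xs = x ∷ y ∷ w ∷ x′ ∷ y′ ∷ w′ ∷ []
      ys = x ∷ y ∷ w ∷ []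
      cx = source {ys = ys} here₀
      cy = source {ys = ys} here₁
      cw = source {ys = ys} here₂
      ¬Mx′x : ¬ M x′ x
      ¬Mx′x = tri-outer t ∘ M-sym
      E₁ = ∅ ⊕ xs
      σ : State 0 E₁
      σ = initial xs ys
        ((~⇒≢ (p~ (nx t)) ∷ ~⇒≢ (q~ (nx t)) ∷ ~⇒≢ (r~ (nx t)) ∷ q≢r (ny t) ∷ p≢r (nz t) ∷ []) ∷
         (~⇒≢ (p~ (ny t)) ∷ p≢r (nx t) ∷ ~⇒≢ (r~ (ny t)) ∷ q≢r (nz t) ∷ []) ∷
         (q≢r (nx t) ∷ p≢r (ny t) ∷ ~⇒≢ (r~ (nz t)) ∷ []) ∷
         (x′≢y′ t ∷ (z′≢x′ t ∘ sym) ∷ []) ∷ (y′≢z′ t ∷ []) ∷ [] ∷ [])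
        ((y , ∈⊕ˡ here₁ , p~ (nx t)) ∷ (x , ∈⊕ˡ here₀ , q~ (ny t)) ∷ (x , ∈⊕ˡ here₀ , p~ (nz t)) ∷ [])
        (cx ∷ cy ∷ cw ∷ forceN (nx t) cx cy cw ∷ forceN (ny t) cy cw cx ∷ forceN (nz t) cw cx cy ∷ [])
        (settled-tri t (∈⊕ˡ here₁) (∈⊕ˡ here₂) ∷ settled-tri (tri-rot t) (∈⊕ˡ here₂) (∈⊕ˡ here₀) ∷
         settled-tri (tri-rot (tri-rot t)) (∈⊕ˡ here₀) (∈⊕ˡ here₁) ∷
         settled-entered (tri x′) (~-sym (r~ (nx t))) ¬Mx′x (∈⊕ˡ here₀) ∷
         settled-entered (tri y′) (~-sym (r~ (ny t))) (tri-outer (tri-rot t) ∘ M-sym) (∈⊕ˡ here₁) ∷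
         settled-entered (tri w′) (~-sym (r~ (nz t))) (tri-outer (tri-rot (tri-rot t)) ∘ M-sym) (∈⊕ˡ here₂) ∷ [])
        0 ≤-refl
      mate-fresh : M x′ v → ¬ v ∈ˡ xs
      mate-fresh m here₀ = ¬Mx′x m
      mate-fresh m here₁ = [ q≢r (nx t) ∘ sym , ~⇒≢ (r~ (nx t)) ∘ sym ]′ (tri-M (tri-rot t) (M-sym m))
      mate-fresh m here₂ = [ ~⇒≢ (r~ (nx t)) ∘ sym , p≢r (nx t) ∘ sym ]′ (tri-M (tri-rot (tri-rot t)) (M-sym m))
      mate-fresh m here₃ = ~⇒≢ (proj₁ m) refl
      mate-fresh m here₄ = x≁y (proj₁ m)
      mate-fresh m here₅ = w≁x (~-sym (proj₁ m))
      go : IsTri x′ → TFS≤ 1 ⊎ PrismCase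
      go (a , _ , _ , _ , _ , s) = branching n (m≤n+m n _) σ (∈⊕ˡ here₀)
        λ a∈ → [ mate-fresh (tri-M-y s) , (λ ()) ]′ (∈⊕⁻ ∅ xs a∈)

  -- Graphs consisting of diamonds

  record Diamond : Set where
    field
      {end₁ end₂ mid₁ mid₂ out₁ out₂} : Fin n
      isDia : Dia end₁ end₂ mid₁ mid₂ out₁ out₂
  open Diamond

  -- The numbering of `Necklace`, with `mid₂` as default beyond 3.
  vertex : Diamond → ℕ → Fin n
  vertex D 0 = end₁ D
  vertex D 1 = end₂ D
  vertex D 2 = mid₁ D
  vertex D _ = mid₂ D

  vertices : Diamond → List (Fin n)
  vertices D = end₁ D ∷ end₂ D ∷ mid₁ D ∷ mid₂ D ∷ []

  vertex∈ : ∀ D j → vertex D j ∈ˡ vertices D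
  vertex∈ D 0 = here₀
  vertex∈ D 1 = here₁
  vertex∈ D 2 = here₂
  vertex∈ D (suc (suc (suc _))) = here₃

  vertex-injective : ∀ D {j j′} → j < 4 → j′ < 4 → vertex D j ≡ vertex D j′ → j ≡ j′
  vertex-injective D {j} {j′} j<4 j′<4 eq = begin
    j                  ≡⟨ toℕ-fromℕ< j<4 ⟨
    toℕ (fromℕ< j<4)   ≡⟨ cong toℕ (lookup-injective (dia-unique (isDia D)) _ _
                            (trans (sym (vertex-lookup j<4)) (trans eq (vertex-lookup j′<4)))) ⟩
    toℕ (fromℕ< j′<4)  ≡⟨ toℕ-fromℕ< j′<4 ⟩
    j′                 ∎
    where
    open ≡-Reasoning
    vertex-lookup : ∀ {j} (j<4 : j < 4) → vertex D j ≡ lookup (vertices D) (fromℕ< j<4)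
    vertex-lookup {0} _ = refl
    vertex-lookup {1} _ = refl
    vertex-lookup {2} _ = refl
    vertex-lookup {3} _ = refl
    vertex-lookup {suc (suc (suc (suc _)))} (s≤s (s≤s (s≤s (s≤s ()))))

  diamond-edge : ∀ D j j′ → T (diamondAdj j j′) → vertex D j ~ vertex D j′
  diamond-edge D 0 2 _ = p~ (na (isDia D))
  diamond-edge D 0 3 _ = q~ (na (isDia D))
  diamond-edge D 1 2 _ = p~ (nb (isDia D))
  diamond-edge D 1 3 _ = q~ (nb (isDia D))
  diamond-edge D 2 0 _ = p~ (nc (isDia D))
  diamond-edge D 2 1 _ = q~ (nc (isDia D))
  diamond-edge D 2 3 _ = r~ (nc (isDia D))
  diamond-edge D 3 0 _ = p~ (nd (isDia D))
  diamond-edge D 3 1 _ = q~ (nd (isDia D))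
  diamond-edge D 3 2 _ = r~ (nd (isDia D))
  diamond-edge D 0 0 ()
  diamond-edge D 0 1 ()
  diamond-edge D 0 (suc (suc (suc (suc _)))) ()
  diamond-edge D 1 0 ()
  diamond-edge D 1 1 ()
  diamond-edge D 1 (suc (suc (suc (suc _)))) ()
  diamond-edge D 2 2 ()
  diamond-edge D 2 (suc (suc (suc (suc _)))) ()
  diamond-edge D 3 3 ()
  diamond-edge D 3 (suc (suc (suc (suc _)))) ()
  diamond-edge D (suc (suc (suc (suc _)))) _ ()

  module NecklaceIso (inDia : ∀ v → InDia v) (D₀ : Diamond) where

    -- The walk leaves at `end₁`, and the diamond found is turned so that it is entered at `end₂`;
    -- this matches the necklace edges from an `a` to the following `b`.
    next : (D : Diamond) → Σ Diamond λ D′ → end₂ D′ ≡ out₁ D × out₂ D′ ≡ end₁ D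
    next D = go (inDia (out₁ D))
      where
      back = ~-sym (r~ (na (isDia D)))
      ¬m = end-outer (isDia D) ∘ M-sym
      go : InDia (out₁ D) → Σ Diamond λ D′ → end₂ D′ ≡ out₁ D × out₂ D′ ≡ end₁ D
      go (inj₁ (_ , _ , _ , _ , _ , D′)) =
        record { isDia = dia-flip D′ } , refl , sym (end-outer-only D′ back ¬m)
      go (inj₂ m) = ⊥-elim (not-mid-outer back ¬m m)

    seq : ℕ → Diamond
    seq zero    = D₀
    seq (suc i) = proj₁ (next (seq i))

    end₂-suc : ∀ i → end₂ (seq (suc i)) ≡ out₁ (seq i)
    end₂-suc i = proj₁ (proj₂ (next (seq i)))

    out₂-suc : ∀ i → out₂ (seq (suc i)) ≡ end₁ (seq i)
    out₂-suc i = proj₂ (proj₂ (next (seq i)))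

    link : ∀ i → end₂ (seq (suc i)) ~ end₁ (seq i)
    link i = subst (end₂ (seq (suc i)) ~_) (out₂-suc i) (r~ (nb (isDia (seq (suc i)))))

    ¬M-link : ∀ i → ¬ M (end₂ (seq (suc i))) (end₁ (seq i))
    ¬M-link i m = end-outer (dia-flip (isDia (seq (suc i)))) (subst (M _) (sym (out₂-suc i)) m)

    Disjoint : ℕ → Set
    Disjoint k = ∀ {i j} s t → i < k → j < k → vertex (seq i) s ≡ vertex (seq j) t → i ≡ j

    -- By uniqueness of outer edges, the ends already linked along the walk admit no second link;
    -- only `end₂` of the starting diamond is free.
    first-return : ∀ {k i} → Disjoint (suc k) → i < suc k →
                   end₂ (seq (suc k)) ∈ˡ vertices (seq i) → end₂ (seq (suc k)) ≡ end₂ (seq 0)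
    first-return {k} {i} dj i<k (hereˡ eq) with m<1+n⇒m<n∨m≡n i<k
    ... | inj₂ refl = contradiction eq (~⇒≢ (link k))
    ... | inj₁ i<k′ = ⊥-elim (p≢q (nc (isDia (seq (suc i)))) (trans (cong (end₁ ∘ seq) i+1≡k) (sym b≡a)))
      where
      b≡a : end₂ (seq (suc i)) ≡ end₁ (seq k)
      b≡a = outer-unique (~-sym (link i)) (¬M-link i ∘ M-sym)
        (subst (_~ _) eq (link k)) (subst (λ x → ¬ M x _) eq (¬M-link k))
      i+1≡k : suc i ≡ k
      i+1≡k = dj 1 0 (s≤s i<k′) ≤-refl b≡a
    first-return {k} {zero} dj i<k (thereˡ (hereˡ eq)) = eq
    first-return {k} {suc i} dj i<k (thereˡ (hereˡ eq)) = contradiction i<k (<-irrefl (cong suc i≡k))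
      where
      i≡k : i ≡ k
      i≡k = dj 0 0 (<-trans (n<1+n i) i<k) ≤-refl
        (outer-unique (link i) (¬M-link i) (subst (_~ _) eq (link k)) (subst (λ x → ¬ M x _) eq (¬M-link k)))
    first-return {k} {i} dj i<k (thereˡ (thereˡ (hereˡ eq))) = ⊥-elim (not-mid-outer (link k) (¬M-link k)
      (subst IsMid (sym eq) (_ , _ , _ , _ , _ , isDia (seq i))))
    first-return {k} {i} dj i<k (thereˡ (thereˡ (thereˡ (hereˡ eq)))) = ⊥-elim (not-mid-outer (link k) (¬M-link k)
      (subst IsMid (sym eq) (_ , _ , _ , _ , _ , dia-swp (isDia (seq i)))))

    new-disjoint : ∀ {k} → Disjoint (suc k) → end₂ (seq (suc k)) ≢ end₂ (seq 0) →
                   ∀ {i} s t → i < suc k → vertex (seq i) s ≢ vertex (seq (suc k)) t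
    new-disjoint {k} dj ne {i} s t i<k eq = ne (first-return dj i<k
      -- `dia-meet` puts `end₁` of the new diamond into the old one; two edges in triangles lead
      -- from there to its `end₂`.
      (dia-closed (isDia (seq i)) (dia-closed (isDia (seq i))
        (dia-meet (isDia (seq i)) (isDia (seq (suc k))) (vertex∈ (seq i) s)
          (subst (_∈ˡ vertices (seq (suc k))) (sym eq) (vertex∈ (seq (suc k)) t)))
        (dia-M-ac (isDia (seq (suc k))))) (M-sym (dia-M-ac (dia-flip (isDia (seq (suc k))))))))

    extend-disjoint : ∀ {k} → Disjoint (suc k) → end₂ (seq (suc k)) ≢ end₂ (seq 0) → Disjoint (suc (suc k))
    extend-disjoint {k} dj ne {i} {j} s t i< j< eq with m<1+n⇒m<n∨m≡n i< | m<1+n⇒m<n∨m≡n j<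
    ... | inj₁ i<k | inj₁ j<k = dj s t i<k j<k eq
    ... | inj₂ refl | inj₂ refl = refl
    ... | inj₁ i<k | inj₂ refl = contradiction eq (new-disjoint dj ne s t i<k)
    ... | inj₂ refl | inj₁ j<k = contradiction (sym eq) (new-disjoint dj ne t s j<k)

    Closed : ℕ → Set
    Closed k = Disjoint (suc k) × end₂ (seq (suc k)) ≡ end₂ (seq 0)

    -- Disjoint diamonds have distinct first ends, so at most `n` of them fit and the walk returns.
    close : ∀ fuel k → n < suc k + fuel → Disjoint (suc k) → ∃[ k ] Closed k
    close zero k h dj = contradiction h (≤⇒≯ (≤-trans (≤-reflexive (+-identityʳ _))
      (injective⇒≤ {f = λ i → end₁ (seq (toℕ i))}
        (λ {i} {j} eq → toℕ-injective (dj 0 0 (toℕ<n i) (toℕ<n j) eq)))))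
    close (suc fuel) k h dj with end₂ (seq (suc k)) ≟ end₂ (seq 0)
    ... | yes eq = k , dj , eq
    ... | no ne  = close fuel (suc k) (subst (n <_) (+-suc (suc k) fuel) h) (extend-disjoint dj ne)

    period : ∃[ k ] Closed k
    period = close n 0 ≤-refl λ { _ _ (s≤s z≤n) (s≤s z≤n) _ → refl }

    module _ (m : ℕ) (dj : Disjoint (2 + m)) (eq₀ : end₂ (seq (2 + m)) ≡ end₂ (seq 0)) where
      k = 2 + m

      link-mod : ∀ {i} → i < k → out₁ (seq i) ≡ end₂ (seq (suc i % k))
      link-mod {i} i<k with m<1+n⇒m<n∨m≡n i<k
      ... | inj₁ i<  = trans (sym (end₂-suc i)) (cong (end₂ ∘ seq) (sym (m<n⇒m%n≡m (s≤s i<))))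
      ... | inj₂ refl = trans (sym (end₂-suc i)) (trans eq₀ (cong (end₂ ∘ seq) (sym (n%n≡0 k))))

      link-mod′ : ∀ {i} → i < k → ∃[ i′ ] (i′ < k × out₂ (seq i) ≡ end₁ (seq i′) × i ≡ suc i′ % k)
      link-mod′ {suc i} i<k =
        i , <-trans (n<1+n i) i<k , out₂-suc i , sym (m<n⇒m%n≡m i<k)
      -- The starting diamond is entered from the last one, because the walk closes up.
      link-mod′ {zero} _ = suc m , ≤-refl ,
        sym (end-outer-only (dia-flip (isDia D₀)) (subst (_~ end₁ (seq (suc m))) eq₀ (link (suc m)))
              (subst (λ x → ¬ M x (end₁ (seq (suc m)))) eq₀ (¬M-link (suc m)))) ,
        sym (n%n≡0 k)

      -- The formula of `necklaceℕ` with block and place as independent arguments.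
      Adj : ℕ → ℕ → ℕ → ℕ → Bool
      Adj i j i′ j′ = ((i ≡ᵇ i′) ∧ diamondAdj j j′)
        ∨ ((j ≡ᵇ 0) ∧ (j′ ≡ᵇ 1) ∧ (i′ ≡ᵇ (suc i % k)))
        ∨ ((j′ ≡ᵇ 0) ∧ (j ≡ᵇ 1) ∧ (i ≡ᵇ (suc i′ % k)))

      adj-inside : ∀ i j j′ → T (diamondAdj j j′) → T (Adj i j i j′)
      adj-inside i j j′ h = Equivalence.from (T-∨ {(i ≡ᵇ i) ∧ diamondAdj j j′})
        (inj₁ (Equivalence.from T-∧ (≡⇒≡ᵇ i i refl , h)))

      Neighbour : ℕ → ℕ → Fin n → Set
      Neighbour i j w = ∃[ i′ ] ∃[ j′ ] (i′ < k × j′ < 4 × vertex (seq i′) j′ ≡ w × T (Adj i j i′ j′))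

      inside : ∀ {i j} j′ → i < k → j′ < 4 → T (diamondAdj j j′) → vertex (seq i) j′ ≡ w → Neighbour i j w
      inside {i = i} {j} j′ i<k j<4 h eq = i , j′ , i<k , j<4 , eq , adj-inside i j j′ h

      neighbour : ∀ {i} j → i < k → vertex (seq i) j ~ w → j < 4 → Neighbour i j w
      neighbour {i = i} 0 i<k e _ with only (na (isDia (seq i))) e
      ... | inj₁ eq = inside 2 i<k (<ᵇ⇒< 2 4 tt) tt (sym eq)
      ... | inj₂ (inj₁ eq) = inside 3 i<k (<ᵇ⇒< 3 4 tt) tt (sym eq)
      ... | inj₂ (inj₂ eq) = suc i % k , 1 , m%n<n (suc i) k , <ᵇ⇒< 1 4 tt , trans (sym (link-mod i<k)) (sym eq) ,
        Equivalence.from (T-∨ {(i ≡ᵇ (suc i % k)) ∧ false}) (inj₂ (Equivalence.from T-∨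
          (inj₁ (≡⇒≡ᵇ (suc i % k) (suc i % k) refl))))
      neighbour {i = i} 1 i<k e _ with only (nb (isDia (seq i))) e
      ... | inj₁ eq = inside 2 i<k (<ᵇ⇒< 2 4 tt) tt (sym eq)
      ... | inj₂ (inj₁ eq) = inside 3 i<k (<ᵇ⇒< 3 4 tt) tt (sym eq)
      ... | inj₂ (inj₂ eq) = let (i′ , i′<k , h , h′) = link-mod′ i<k in
        i′ , 0 , i′<k , <ᵇ⇒< 0 4 tt , trans (sym h) (sym eq) ,
        Equivalence.from (T-∨ {(i ≡ᵇ i′) ∧ false}) (inj₂ (≡⇒≡ᵇ i (suc i′ % k) h′))
      neighbour {i = i} 2 i<k e _ with only (nc (isDia (seq i))) e
      ... | inj₁ eq = inside 0 i<k (<ᵇ⇒< 0 4 tt) tt (sym eq)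
      ... | inj₂ (inj₁ eq) = inside 1 i<k (<ᵇ⇒< 1 4 tt) tt (sym eq)
      ... | inj₂ (inj₂ eq) = inside 3 i<k (<ᵇ⇒< 3 4 tt) tt (sym eq)
      neighbour {i = i} 3 i<k e _ with only (nd (isDia (seq i))) e
      ... | inj₁ eq = inside 0 i<k (<ᵇ⇒< 0 4 tt) tt (sym eq)
      ... | inj₂ (inj₁ eq) = inside 1 i<k (<ᵇ⇒< 1 4 tt) tt (sym eq)
      ... | inj₂ (inj₂ eq) = inside 2 i<k (<ᵇ⇒< 2 4 tt) tt (sym eq)
      neighbour (suc (suc (suc (suc _)))) _ _ (s≤s (s≤s (s≤s (s≤s ()))))

      link-edge : ∀ {i j i′ j′} → i < k → T ((j ≡ᵇ 0) ∧ (j′ ≡ᵇ 1) ∧ (i′ ≡ᵇ (suc i % k))) →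
                  vertex (seq i) j ~ vertex (seq i′) j′
      link-edge {i} {j} {i′} {j′} i<k h with Equivalence.to (T-∧ {j ≡ᵇ 0}) h
      ... | hj , h′ with Equivalence.to (T-∧ {j′ ≡ᵇ 1}) h′
      ... | hj′ , hi with ≡ᵇ⇒≡ j 0 hj | ≡ᵇ⇒≡ j′ 1 hj′ | ≡ᵇ⇒≡ i′ _ hi
      ... | refl | refl | refl = subst (_ ~_) (link-mod i<k) (r~ (na (isDia (seq i))))

      adj-edge : ∀ {i j i′ j′} → i < k → i′ < k → T (Adj i j i′ j′) → vertex (seq i) j ~ vertex (seq i′) j′
      adj-edge {i} {j} {i′} {j′} i<k i′<k h with Equivalence.to (T-∨ {(i ≡ᵇ i′) ∧ diamondAdj j j′}) h
      ... | inj₂ h′ with Equivalence.to (T-∨ {(j ≡ᵇ 0) ∧ (j′ ≡ᵇ 1) ∧ (i′ ≡ᵇ (suc i % k))}) h′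
      ...   | inj₁ l = link-edge {i} {j} {i′} {j′} i<k l
      ...   | inj₂ l = ~-sym (link-edge {i′} {j′} {i} {j} i′<k l)
      adj-edge {i} {j} {i′} {j′} i<k i′<k h | inj₁ h′ with Equivalence.to (T-∧ {i ≡ᵇ i′}) h′
      ... | hi , hd with ≡ᵇ⇒≡ i i′ hi
      ... | refl = diamond-edge (seq i) j j′ hd

      iso : Iso G (Necklace m)
      iso = mkIso pt inj zero nbr (λ s t → adj-edge (quot<k s) (quot<k t))
        where
        pt : Fin (4 * k) → Fin n
        pt s = vertex (seq (toℕ s / 4)) (toℕ s % 4)
        quot<k : ∀ (s : Fin (4 * k)) → toℕ s / 4 < k
        quot<k s = block-quot<  k s
        inj : ∀ s t → pt s ≡ pt t → s ≡ t
        inj s t eq = block-ext s t eqi (vertex-injective (seq (toℕ t / 4)) (m%n<n (toℕ s) 4) (m%n<n (toℕ t) 4)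
          (trans (cong (λ i → vertex (seq i) (toℕ s % 4)) (sym eqi)) eq))
          where
          eqi : toℕ s / 4 ≡ toℕ t / 4
          eqi = dj (toℕ s % 4) (toℕ t % 4) (quot<k s) (quot<k t) eq
        nbr : ∀ s {w} → pt s ~ w → ∃[ t ] (pt t ≡ w × T (Necklace m s t))
        nbr s e with neighbour (toℕ s % 4) (quot<k s) e (m%n<n (toℕ s) 4)
        ... | i′ , j′ , i′< , j′< , eq , h with block-index k i′< j′<
        ...   | t , refl , refl = t , eq , h

    necklace : InNcubic G
    necklace with period
    -- A return after one diamond would make its two ends adjacent.
    ... | zero , _ , eq = contradiction (trans (sym (end₂-suc 0)) eq) (a′≢b (isDia D₀))
    ... | suc m , dj , eq = m , iso m dj eq

  outcome : TFS≤ 1 ⊎ ((InNcubic G ⊎ Iso G Prism) × TFS≤ 0)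
  outcome with any? inDia?
    where
    inDia? : ∀ v → Dec (InDia v)
    inDia? v with kind v
    ... | inj₁ t = no (tri-not-dia t)
    ... | inj₂ D = yes D
  ... | yes (v , inj₁ (_ , _ , _ , _ , _ , D)) =
    Sum.map₂ (λ (ds , T) → inj₁ (NecklaceIso.necklace ds (record { isDia = D })) , T) (with-diamond D)
  ... | yes (v , inj₂ (_ , _ , _ , _ , _ , D)) =
    Sum.map₂ (λ (ds , T) → inj₁ (NecklaceIso.necklace ds (record { isDia = D })) , T) (with-diamond D)
  ... | no ¬D = Sum.map₂ (λ (iso , T) → inj₂ iso , T)
    (without-diamond (λ v → [ id , (λ D → ⊥-elim (¬D (v , D))) ]′ (kind v)) (proj₁ connected))

  -- Lower bounds for the necklaces and the prism

  length≤count : ∀ {S : VSet n} {xs} → Unique xs → All (_∈ S) xs → length xs ≤ count S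
  length≤count {S} {xs} uniq all =
    count-inj S (lookup xs) (lookup-injective uniq) (λ i → All.lookup all (∈-lookup i))

  -- The derivation is followed back: whatever a force uses from outside `S` was itself forced
  -- earlier.
  first-force : ∀ {S : VSet n} → Colored G S v → v ∉ S →
                ∃[ u ] ∃[ w ] (u ∈ S × u ~ w × (∀ x → u ~ x → x ≢ w → x ∈ S))
  first-force (init v∈) v∉ = contradiction v∈ v∉
  first-force {S = S} (force {u} {w} cu e o) v∉ with u ∈? S
  ... | no u∉ = first-force cu u∉
  ... | yes u∈ with any? (λ x → T? (G u x) ×-dec (¬? (x ≟ w) ×-dec ¬? (x ∈? S)))
  ...   | yes (x , ux , x≢w , x∉) = first-force (o x ux x≢w) x∉
  ...   | no none = u , w , u∈ , e ,
          λ x ux x≢w → decidable-stable (x ∈? S) λ x∉ → none (x , ux , x≢w , x∉)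

  otherNbrs : u ~ w → ∃[ p ] ∃[ q ] Nbrs u w p q
  otherNbrs {u} e = let (_ , _ , _ , N) = threeNbrs u in go N (only N e)
    where
    go : Nbrs u p q r → w ≡ p ⊎ w ≡ q ⊎ w ≡ r → ∃[ x ] ∃[ y ] Nbrs u w x y
    go N (inj₁ refl)        = _ , _ , N
    go N (inj₂ (inj₁ refl)) = _ , _ , rot N
    go N (inj₂ (inj₂ refl)) = _ , _ , rot (rot N)

  three≤forcing : ∀ {S : VSet n} → ForcingSet G S → v ∉ S → 3 ≤ count S
  three≤forcing {v} {S} fs v∉ with first-force (fs v) v∉
  ... | u , w , u∈ , e , others with otherNbrs e
  ... | p , q , N = length≤count
    ((~⇒≢ (q~ N) ∷ ~⇒≢ (r~ N) ∷ []) ∷ (q≢r N ∷ []) ∷ [] ∷ [])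
    (u∈ ∷ others p (q~ N) (p≢q N ∘ sym) ∷ others q (r~ N) (p≢r N ∘ sym) ∷ [])

  prism-lower : Iso G Prism → ∀ {S} → ForcingSet G S → n ≤ 2 * count S
  prism-lower (f , _) {S} fs with covers? S
  ... | inj₁ all = ≤-trans (≤-reflexive (sym (count-full S all))) (m≤m+n _ _)
  ... | inj₂ (v , v∉) = ≤-trans (≤-reflexive (↔⇒≡ f)) (*-monoʳ-≤ 2 (three≤forcing fs v∉))

  -- Each of c, d blocks every force on the other one.
  twins-block : ∀ {S : VSet n} → Nbrs c a b d → Nbrs d a b c → c ∉ S → d ∉ S →
                ∀ {v} → Colored G S v → v ≢ c × v ≢ d
  twins-block Nc Nd c∉ d∉ (init v∈) = (λ { refl → c∉ v∈ }) , (λ { refl → d∉ v∈ })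
  twins-block {c} {a} {b} {d} {S} Nc Nd c∉ d∉ (force {u} {w} cu e o) =
    (λ { refl → not-c (only Nc (~-sym e)) refl }) , (λ { refl → not-d (only Nd (~-sym e)) refl })
    where
    ih = twins-block Nc Nd c∉ d∉ cu
    c≢d = ~⇒≢ (r~ Nc)
    not-c : u ≡ a ⊎ u ≡ b ⊎ u ≡ d → w ≢ c
    not-c (inj₁ refl) refl = proj₂ (twins-block Nc Nd c∉ d∉ (o d (~-sym (p~ Nd)) (c≢d ∘ sym))) refl
    not-c (inj₂ (inj₁ refl)) refl = proj₂ (twins-block Nc Nd c∉ d∉ (o d (~-sym (q~ Nd)) (c≢d ∘ sym))) refl
    not-c (inj₂ (inj₂ refl)) refl = proj₂ ih refl
    not-d : u ≡ a ⊎ u ≡ b ⊎ u ≡ c → w ≢ d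
    not-d (inj₁ refl) refl = proj₁ (twins-block Nc Nd c∉ d∉ (o c (~-sym (p~ Nc)) c≢d)) refl
    not-d (inj₂ (inj₁ refl)) refl = proj₁ (twins-block Nc Nd c∉ d∉ (o c (~-sym (q~ Nc)) c≢d)) refl
    not-d (inj₂ (inj₂ refl)) refl = proj₁ ih refl

  record TwoIn (S : VSet n) (xs : List (Fin n)) : Set where
    field
      pt₁ pt₂ : Fin n
      pt₁≢pt₂ : pt₁ ≢ pt₂
      pt₁∈S   : pt₁ ∈ S
      pt₂∈S   : pt₂ ∈ S
      pt₁∈xs  : pt₁ ∈ˡ xs
      pt₂∈xs  : pt₂ ∈ˡ xs
  open TwoIn

  -- By `twins-block` one of `c`, `d` is in `S`; its support in `S` is a neighbour, hence also in
  -- the diamond.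
  two-in-diamond : ∀ {S : VSet n} → Nbrs c a b d → Nbrs d a b c → TotalForcingSet G S →
                   TwoIn S (a ∷ b ∷ c ∷ d ∷ [])
  two-in-diamond {c} {a} {b} {d} {S} Nc Nd (fs , total) with c ∈? S | d ∈? S
  ... | no c∉ | no d∉ = ⊥-elim (proj₁ (twins-block Nc Nd c∉ d∉ (fs c)) refl)
  ... | yes c∈ | _ = let (u , u∈ , e) = total c c∈ in record
    { pt₁≢pt₂ = ~⇒≢ e ; pt₁∈S = c∈ ; pt₂∈S = u∈ ; pt₁∈xs = here₂
    ; pt₂∈xs = [ (λ { refl → here₀ }) , [ (λ { refl → here₁ }) , (λ { refl → here₃ }) ]′ ]′ (only Nc e) }
  ... | _ | yes d∈ = let (u , u∈ , e) = total d d∈ in record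
    { pt₁≢pt₂ = ~⇒≢ e ; pt₁∈S = d∈ ; pt₂∈S = u∈ ; pt₁∈xs = here₃
    ; pt₂∈xs = [ (λ { refl → here₀ }) , [ (λ { refl → here₁ }) , (λ { refl → here₂ }) ]′ ]′ (only Nd e) }

  module _ (m : ℕ) (iso : Iso G (Necklace m)) {S : VSet n} (tfs : TotalForcingSet G S) where
    open Inverse (proj₁ iso) using (to; from; strictlyInverseˡ)

    pos : Fin (2 + m) → ∀ {j} → j < 4 → Fin (4 * (2 + m))
    pos i j<4 = proj₁ (block-index (2 + m) (toℕ<n i) j<4)

    at : Fin (2 + m) → ∀ {j} → j < 4 → Fin n
    at i j<4 = from (pos i j<4)

    at-edge : ∀ i {j j′} (j<4 : j < 4) (j′<4 : j′ < 4) → T (diamondAdj j j′) → at i j<4 ~ at i j′<4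
    at-edge i {j} {j′} j<4 j′<4 h = subst T (sym (trans (proj₂ iso _ _)
        (cong₂ (Necklace m) (strictlyInverseˡ _) (strictlyInverseˡ _))))
      (Equivalence.from T-∨ (inj₁ (Equivalence.from T-∧
        ( ≡⇒≡ᵇ _ _ (trans (proj₁ ix) (sym (proj₁ iy)))
        , subst₂ (λ j j′ → T (diamondAdj j j′)) (sym (proj₂ ix)) (sym (proj₂ iy)) h))))
      where
      ix = proj₂ (block-index (2 + m) (toℕ<n i) j<4)
      iy = proj₂ (block-index (2 + m) (toℕ<n i) j′<4)

    lt₀ : 0 < 4
    lt₀ = <ᵇ⇒< 0 4 tt
    lt₁ : 1 < 4
    lt₁ = <ᵇ⇒< 1 4 tt
    lt₂ : 2 < 4
    lt₂ = <ᵇ⇒< 2 4 tt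
    lt₃ : 3 < 4
    lt₃ = <ᵇ⇒< 3 4 tt

    ends≢ : ∀ i → at i lt₀ ≢ at i lt₁
    ends≢ i eq = contradiction (trans (sym (proj₂ (proj₂ (block-index (2 + m) (toℕ<n i) lt₀))))
      (trans (cong (λ x → toℕ x % 4) (trans (sym (strictlyInverseˡ _)) (trans (cong to eq) (strictlyInverseˡ _))))
             (proj₂ (proj₂ (block-index (2 + m) (toℕ<n i) lt₁))))) λ ()

    block : Fin (2 + m) → List (Fin n)
    block i = at i lt₀ ∷ at i lt₁ ∷ at i lt₂ ∷ at i lt₃ ∷ []

    two-in-block : ∀ i → TwoIn S (block i)
    two-in-block i = two-in-diamond
      (mkNbrs (at-edge i lt₂ lt₀ tt) (at-edge i lt₂ lt₁ tt) (at-edge i lt₂ lt₃ tt)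
        (ends≢ i) (~⇒≢ (at-edge i lt₀ lt₃ tt)) (~⇒≢ (at-edge i lt₁ lt₃ tt)))
      (mkNbrs (at-edge i lt₃ lt₀ tt) (at-edge i lt₃ lt₁ tt) (at-edge i lt₃ lt₂ tt)
        (ends≢ i) (~⇒≢ (at-edge i lt₀ lt₂ tt)) (~⇒≢ (at-edge i lt₁ lt₂ tt)))
      tfs

    block-number : ∀ i → All (λ x → toℕ (to x) / 4 ≡ toℕ i) (block i)
    block-number i = num lt₀ ∷ num lt₁ ∷ num lt₂ ∷ num lt₃ ∷ []
      where
      num : ∀ {j} (j<4 : j < 4) → toℕ (to (at i j<4)) / 4 ≡ toℕ i
      num j<4 = trans (cong (λ x → toℕ x / 4) (strictlyInverseˡ _))
        (proj₁ (proj₂ (block-index (2 + m) (toℕ<n i) j<4)))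

    select : Fin (2 + m) × Fin 2 → Fin n
    select (i , zero)     = pt₁ (two-in-block i)
    select (i , suc zero) = pt₂ (two-in-block i)

    select∈S : ∀ z → select z ∈ S
    select∈S (i , zero)     = pt₁∈S (two-in-block i)
    select∈S (i , suc zero) = pt₂∈S (two-in-block i)

    select∈block : ∀ z → select z ∈ˡ block (proj₁ z)
    select∈block (i , zero)     = pt₁∈xs (two-in-block i)
    select∈block (i , suc zero) = pt₂∈xs (two-in-block i)

    same-block : ∀ z z′ → select z ≡ select z′ → proj₁ z ≡ proj₁ z′
    same-block z z′ eq = toℕ-injective
      (trans (sym (All.lookup (block-number (proj₁ z)) (select∈block z)))
        (trans (cong (λ x → toℕ (to x) / 4) eq) (All.lookup (block-number (proj₁ z′)) (select∈block z′))))

    same-index : ∀ i s s′ → select (i , s) ≡ select (i , s′) → s ≡ s′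
    same-index i zero zero _             = refl
    same-index i zero (suc zero) eq      = contradiction eq (pt₁≢pt₂ (two-in-block i))
    same-index i (suc zero) zero eq      = contradiction (sym eq) (pt₁≢pt₂ (two-in-block i))
    same-index i (suc zero) (suc zero) _ = refl

    select-injective : ∀ z z′ → select z ≡ select z′ → z ≡ z′
    select-injective (i , s) (i′ , s′) eq = go (same-block (i , s) (i′ , s′) eq) eq
      where
      go : i ≡ i′ → select (i , s) ≡ select (i′ , s′) → (i , s) ≡ (i′ , s′)
      go refl eq = cong (i ,_) (same-index i s s′ eq)

    necklace-lower : n ≤ 2 * count S
    necklace-lower = begin
      n                 ≡⟨ ↔⇒≡ (proj₁ iso) ⟩
      4 * (2 + m)       ≡⟨ rearrange (2 + m) ⟩
      2 * ((2 + m) * 2) ≤⟨ *-monoʳ-≤ 2 (count-inj S (select ∘ remQuot 2) inj (select∈S ∘ remQuot 2)) ⟩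
      2 * count S       ∎
      where
      open ≤-Reasoning
      rearrange : ∀ k → 4 * k ≡ 2 * (k * 2)
      rearrange = solve-∀
      inj : ∀ x y → select (remQuot {2 + m} 2 x) ≡ select (remQuot 2 y) → x ≡ y
      inj x y eq = trans (sym (combine-remQuot {2 + m} 2 x))
        (trans (cong (uncurry combine) (select-injective (remQuot {2 + m} 2 x) (remQuot {2 + m} 2 y) eq))
               (combine-remQuot {2 + m} 2 y))

  extremal-lower : InNcubic G ⊎ Iso G Prism → ∀ {S} → TotalForcingSet G S → n ≤ 2 * count S
  extremal-lower (inj₁ (m , iso)) tfs = necklace-lower m iso tfs
  extremal-lower (inj₂ iso) (fs , _)  = prism-lower iso fs

-- The minimum is attained

module _ {n : ℕ} (G : Graph n) where
  private variable
    S S′ : VSet n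

  Forces : VSet n → Fin n → Fin n → Set
  Forces C u w = u ∈ C × w ∉ C × T (G u w) × (∀ x → T (G u x) → x ≢ w → x ∈ C)

  forces? : ∀ C u w → Dec (Forces C u w)
  forces? C u w = (u ∈? C) ×-dec ¬? (w ∈? C) ×-dec T? (G u w) ×-dec
    all? (λ x → T? (G u x) →-dec (¬? (x ≟ w) →-dec (x ∈? C)))

  -- Forces are applied until none is left, which turns `Colored` into a decidable set; the fuel
  -- bounds the vertices outside `C`.
  closure : ∀ fuel (C : VSet n) → n ≤ count C + fuel → (∀ {v} → v ∈ S → v ∈ C) →
            (∀ {v} → v ∈ C → Colored G S v) →
            ∃[ C′ ] ((∀ {v} → v ∈ C′ → Colored G S v) × (∀ {v} → Colored G S v → v ∈ C′))
  closure fuel C h S⊆C sound with any? (λ u → any? (forces? C u))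
  closure {S} fuel C h S⊆C sound | no none = C , sound , complete
    where
    complete : ∀ {v} → Colored G S v → v ∈ C
    complete (init v∈) = S⊆C v∈
    complete (force {u} {w} cu e o) = decidable-stable (w ∈? C) λ w∉ →
      none (u , w , complete cu , w∉ , e , λ x ux x≢w → complete (o x ux x≢w))
  closure zero C h S⊆C sound | yes (_ , w , _ , w∉ , _) =
    contradiction (≤-trans h (≤-reflexive (+-identityʳ _))) (<⇒≱ (count<n C w∉))
  closure (suc fuel) C h S⊆C sound | yes (u , w , u∈ , w∉ , e , o) =
    closure fuel (C ⊕ (w ∷ [])) h′ (∈⊕ʳ (w ∷ []) ∘ S⊆C)
      (λ v∈ → [ (λ { (hereˡ refl) → force (sound u∈) e λ x ux x≢w → sound (o x ux x≢w) }) , sound ]′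
                (∈⊕⁻ C (w ∷ []) v∈))
    where
    h′ : n ≤ count (C ⊕ (w ∷ [])) + fuel
    h′ = ≤-trans h (≤-reflexive (trans (+-suc _ fuel) (cong (_+ fuel) (sym (count-insert C w w∉)))))

  forcing? : ∀ S → Dec (ForcingSet G S)
  forcing? S with closure n S (m≤n+m n _) id init
  ... | C , sound , complete = Dec.map′ (λ all v → sound (all v)) (λ fs v → complete (fs v)) (all? (_∈? C))

  totalForcing? : ∀ S → Dec (TotalForcingSet G S)
  totalForcing? S = forcing? S ×-dec
    all? (λ v → (v ∈? S) →-dec any? (λ u → (u ∈? S) ×-dec T? (G v u)))

  totalForcing-cong : (∀ v → S v ≡ S′ v) → TotalForcingSet G S → TotalForcingSet G S′
  totalForcing-cong {S} {S′} eq (fs , total) =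
    (λ v → Colored-mono (λ u → to) (fs v)) ,
    (λ v v∈ → let (u , u∈ , e) = total v (subst T (sym (eq v)) v∈) in u , to u∈ , e)
    where
    to : ∀ {v} → v ∈ S → v ∈ S′
    to {v} = subst T (eq v)

  -- The search runs over Boolean vectors; a subset given as a function is exchanged for its
  -- tabulation.
  smaller? : ∀ k → Dec (∃[ S ] (TotalForcingSet G S × count S < k))
  smaller? k = Dec.map′ (λ (p , tfs , lt) → Vec.lookup p , tfs , lt)
    (λ (S , tfs , lt) → Vec.tabulate S
      , totalForcing-cong (λ v → sym (lookup∘tabulate S v)) tfs
      , subst (_< k) (count-cong (λ v → sym (lookup∘tabulate S v))) lt)
    (anySubset? (λ p → totalForcing? (Vec.lookup p) ×-dec (count (Vec.lookup p) <? k)))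

  -- Descent to smaller total forcing sets, with the size as fuel.
  minimum : ∀ fuel S → TotalForcingSet G S → count S ≤ fuel → ∃[ k ] (IsFt G k × k ≤ count S)
  minimum fuel S tfs h with smaller? (count S)
  ... | no none = count S , ((S , tfs , refl) , λ S′ tfs′ → ≮⇒≥ (λ lt → none (S′ , tfs′ , lt))) , ≤-refl
  minimum zero S tfs h | yes (S′ , _ , lt) = contradiction (≤-trans lt h) λ ()
  minimum (suc fuel) S tfs h | yes (S′ , tfs′ , lt) =
    let (k , ft , k≤) = minimum fuel S′ tfs′ (s≤s⁻¹ (≤-trans lt h))
    in k , ft , ≤-trans k≤ (<⇒≤ lt)

theorem2 : (n : ℕ) (G : Graph n) → IsSimple G → Connected G → ClawFree G → Cubic G →
    ¬ Iso G K4 →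
    ∃[ k ] (IsFt G k × 2 * k ≤ n × ((2 * k ≡ n) ⇔ (InNcubic G ⊎ Iso G Prism)))
theorem2 n G simple connected clawFree cubic G≇K4 = conclude outcome
  where
  open ClawFreeCubic G simple connected clawFree cubic G≇K4
  lower : ∀ {k} → IsFt G k → InNcubic G ⊎ Iso G Prism → n ≤ 2 * k
  lower ((S , tfs , refl) , _) ext = extremal-lower ext tfs
  conclude : TFS≤ 1 ⊎ ((InNcubic G ⊎ Iso G Prism) × TFS≤ 0) →
             ∃[ k ] (IsFt G k × 2 * k ≤ n × ((2 * k ≡ n) ⇔ (InNcubic G ⊎ Iso G Prism)))
  -- The surplus makes the bound strict, while `lower` gives `n ≤ 2 * k` for extremal graphs, so
  -- both sides of the equivalence fail here.
  conclude (inj₁ (S , tfs , h)) =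
    let (k , ft , k≤) = minimum G (count S) S tfs ≤-refl
        2k<n = ≤-trans (≤-reflexive (+-comm 1 _)) (≤-trans (+-monoˡ-≤ 1 (*-monoʳ-≤ 2 k≤)) h)
    in k , ft , <⇒≤ 2k<n , mk⇔ (λ eq → contradiction 2k<n (<-irrefl eq))
                               (λ ext → ≤-antisym (<⇒≤ 2k<n) (lower ft ext))
  conclude (inj₂ (ext , S , tfs , h)) =
    let (k , ft , k≤) = minimum G (count S) S tfs ≤-refl
        2k≤n = ≤-trans (*-monoʳ-≤ 2 k≤) (≤-trans (m≤m+n _ 0) h)
    in k , ft , 2k≤n , mk⇔ (λ _ → ext) (λ ext → ≤-antisym 2k≤n (lower ft ext))
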